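{- Let $p$ be an odd prime. Then $$\sum_{k=1}^{p-1}2^{k}C_k^{(2)}\equiv 2\left((-1)^{(p-1)/2}-1\right) \pmod p$$ and $$\sum_{k=1}^{p-1} \frac{2^{k}C_k^{(2)}}{k} \equiv 4\left(1-(-1)^{(p-1)/2}\right)\pmod p.$$
   Context: For $k\in\mathbb{N}=\{0,1,2,\ldots\}$, $C_k^{(2)}=\frac{1}{2k+1}\binom{3k}{k}=\binom{3k}{k}-2\binom{3k}{k-1}$ denotes the $k$th Catalan number of order 2 (an integer), where $\binom{x}{ -1}$ is regarded as $0$. Congruences modulo $p$ between rational numbers whose denominators are prime to $p$ are understood in the ring of rationals with denominator prime to $p$ (i.e. $a\equiv b \pmod p$ means that $a-b$ is $p$ times such a rational). -}

module Defs where

open import Data.Fin.Base using (toℕ)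
open import Data.Integer.Base using (ℤ; +_)
open import Data.Nat.Base as ℕ using (ℕ; suc; NonZero)
open import Data.Nat.Combinatorics using (_C_)
open import Data.Nat.Coprimality using (Coprime)
open import Data.Product.Base using (∃-syntax; _×_)
open import Data.Rational.Base using (ℚ; _*_; _-_; _/_; ↧ₙ_)
open import Data.Rational.Properties using (+-0-commutativeMonoid)
open import Relation.Binary.PropositionalEquality.Core using (_≡_)

open import Algebra.Properties.CommutativeMonoid.Sum +-0-commutativeMonoid
  using (sum-syntax)

fromℤ : ℤ → ℚ
fromℤ z = z / 1

-- Kept as a rational number, so that its integrality is not built in through
-- a truncating division.
catalan₂ : ℕ → ℚ
catalan₂ k = + ((3 ℕ.* k) C k) / suc (2 ℕ.* k)

-- The sum of f k over 1 ≤ k ≤ n.  The summand receives a proof that k ≢ 0,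
-- so that it may divide by k.
sum-from-1 : (n : ℕ) → ((k : ℕ) → .{{_ : NonZero k}} → ℚ) → ℚ
sum-from-1 n f = ∑[ i < n ] f (suc (toℕ i))

syntax sum-from-1 n (λ k → e) = ∑[1≤ k ≤ n ] e

infix 4 _≡_[mod_]

-- Congruence in the ring of rationals with denominator prime to p.  The
-- denominator ↧ₙ r is that of r in lowest terms.
_≡_[mod_] : ℚ → ℚ → ℕ → Set
a ≡ b [mod p ] = ∃[ r ] Coprime (↧ₙ r) p × a - b ≡ fromℤ (+ p) * r

{-# OPTIONS --safe #-}

-- Since C_k⁽²⁾ = [xᵏ] (1-2x)(1+x)³ᵏ, the first sum (with its k = 0 term) is the coefficient of
-- xᵖ⁻¹ in (1-2x) G, where G = Σ_{k<p} xᵖ⁻¹⁻ᵏ gᵏ, g = 2(1+x)³ and (g - x) G = gᵖ - xᵖ. Below xᵖ the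
-- right-hand side is the constant 2 modulo p, and g - x = (2+x)(1+2x+2x²) gives the partial fractions
-- (1-2x)/(g-x) = 1/(2+x) - 2x/(1+2x+2x²). The coefficients of the second one are imaginary parts of
-- powers of 1+i up to sign, and (1+i)ᵖ ≡ 1 + (-1)^((p-1)/2) i modulo p.
--
-- For the second sum, C_k⁽²⁾/k = C(3k,k)/k - 2 C_k⁽²⁾, so it remains to see that Σ 2ᵏ C(3k,k)/k ≡ 0.
-- As [xᵖ⁻ᵏ] (1-x)ᵖ ≡ p/k modulo p², p times this sum is the middle part of
-- [xᵖ] (g-x)ᵖ = [xᵖ] (2+x)ᵖ (1+2x+2x²)ᵖ. Middle coefficients of p-th powers are divisible by p, so
-- modulo p² only the end terms of such products count. With t = Re (1+i)ᵖ, for which 2t² = 2ᵖ and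
-- t ≡ 1 modulo p, the middle part is 4t³ - 6t² + 2 = 2(t-1)²(2t+1) ≡ 0 modulo p².

module Submission where

open import Defs
open import Algebra.Bundles using (CommutativeRing)
import Algebra.Properties.CommutativeMonoid.Sum as Sum
open import Algebra.Solver.Ring.AlmostCommutativeRing
  using (fromCommutativeRing; _-Raw-AlmostCommutative⟶_)
import Algebra.Solver.Ring as RingSolver
open import Algebra.Structures using (IsCommutativeRing)
open import Data.Fin.Base using (Fin; zero; suc; toℕ)
open import Data.Fin.Properties using (toℕ<n; toℕ≤pred[n])
open import Data.Integer.Base as ℤ using (ℤ; +_; 0ℤ; -1ℤ; 1ℤ; ∣_∣)
import Data.Integer.GCD as ℤ
import Data.Integer.Properties as ℤ
open import Data.Integer.Tactic.RingSolver using (solve-∀)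
open import Data.Maybe.Base using (Maybe; just; nothing)
open import Data.Nat.Base as ℕ using (ℕ; zero; suc; 2+; _∸_; NonZero)
open import Data.Nat.Combinatorics using (_C_; nCn≡1; nCk+nC[k+1]≡[n+1]C[k+1])
open import Data.Nat.Coprimality as Coprimality using (Coprime)
import Data.Nat.DivMod as ℕ
import Data.Nat.Divisibility as ℕ
open import Data.Nat.Primality using (Prime; euclidsLemma; prime⇒irreducible; ¬prime[1])
import Data.Nat.Properties as ℕ
open import Data.Product.Base using (_×_; _,_; proj₁; ∃-syntax)
open import Data.Rational.Base as ℚ using (ℚ; ↧ₙ_; toℚᵘ)
import Data.Rational.Properties as ℚ
open import Data.Rational.Solver using (module +-*-Solver)
open import Data.Rational.Unnormalised.Base as ℚᵘ using (mkℚᵘ; *≡*; _≃_)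
import Data.Rational.Unnormalised.Properties as ℚᵘ
open import Data.Sum.Base using (inj₁; inj₂)
open import Function.Base using (_∘_)
open import Level using (0ℓ)
open import Relation.Binary.Bundles using (Setoid)
open import Relation.Binary.PropositionalEquality
open import Relation.Nullary.Decidable.Core using (yes; no)
open import Relation.Nullary.Negation.Core using (¬_; contradiction)

module _ where

  open import Data.Integer.Base using (_+_; _*_; -_; _-_)
  open Sum ℤ.+-0-commutativeMonoid using (sum-syntax; sum-cong-≗; ∑-distrib-+)
  open import Data.Integer.Divisibility.Signed

  -- Formal power series over ℤ

  Series : Set
  Series = ℕ → ℤ

  infixl 6 _⊕_
  infixl 7 _⊛_
  infix  8 ⊝_

  const : ℤ → Series
  const c zero    = c
  const c (suc _) = 0ℤ

  X : Series
  X zero    = 0ℤ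
  X (suc n) = const 1ℤ n

  _⊕_ : Series → Series → Series
  (f ⊕ g) n = f n + g n

  ⊝_ : Series → Series
  (⊝ f) n = - f n

  -- The Cauchy product, by recursion along the left factor: f g = f₀ g + x f′ g with f′ the tail of
  -- f. The ring laws then follow by induction on the index with the series varying, without finite
  -- sums.
  _⊛_ : Series → Series → Series
  (f ⊛ g) zero    = f 0 * g 0
  (f ⊛ g) (suc n) = f 0 * g (suc n) + ((f ∘ suc) ⊛ g) n

  ⊛-cong : ∀ {f f′ g g′} → f ≗ f′ → g ≗ g′ → f ⊛ g ≗ f′ ⊛ g′
  ⊛-cong p q zero    = cong₂ _*_ (p 0) (q 0)
  ⊛-cong p q (suc n) =
    cong₂ _+_ (cong₂ _*_ (p 0) (q (suc n))) (⊛-cong (p ∘ suc) q n)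

  ⊛-distribʳ-⊕ : ∀ f g h → (g ⊕ h) ⊛ f ≗ g ⊛ f ⊕ h ⊛ f
  ⊛-distribʳ-⊕ f g h zero    = ℤ.*-distribʳ-+ (f 0) (g 0) (h 0)
  ⊛-distribʳ-⊕ f g h (suc n)
    rewrite ⊛-distribʳ-⊕ f (g ∘ suc) (h ∘ suc) n =
    lemma (f (suc n)) (g 0) (h 0) _ _
    where
    lemma : ∀ a b c d e → (b + c) * a + (d + e) ≡ b * a + d + (c * a + e)
    lemma = solve-∀

  ⊛-scaleˡ : ∀ c f g → (λ k → c * f k) ⊛ g ≗ (λ n → c * (f ⊛ g) n)
  ⊛-scaleˡ c f g zero    = ℤ.*-assoc c (f 0) (g 0)
  ⊛-scaleˡ c f g (suc n) rewrite ⊛-scaleˡ c (f ∘ suc) g n =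
    lemma c (f 0) (g (suc n)) _
    where
    lemma : ∀ a b c d → a * b * c + a * d ≡ a * (b * c + d)
    lemma = solve-∀

  ⊛-assoc : ∀ f g h → (f ⊛ g) ⊛ h ≗ f ⊛ (g ⊛ h)
  ⊛-assoc f g h zero    = ℤ.*-assoc (f 0) (g 0) (h 0)
  ⊛-assoc f g h (suc n)
    rewrite ⊛-distribʳ-⊕ h (λ k → f 0 * g (suc k)) ((f ∘ suc) ⊛ g) n
          | ⊛-scaleˡ (f 0) (g ∘ suc) h n
          | ⊛-assoc (f ∘ suc) g h n =
    lemma (f 0) (g 0) (h (suc n)) _ _
    where
    lemma : ∀ a b c d e → a * b * c + (a * d + e) ≡ a * (b * c + d) + e
    lemma = solve-∀

  -- The mirror image of the defining recursion, splitting off the constant term of the right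
  -- factor; commutativity rests on it.
  ⊛-unfoldʳ : ∀ f g n → (f ⊛ g) (suc n) ≡ f (suc n) * g 0 + (f ⊛ (g ∘ suc)) n
  ⊛-unfoldʳ f g zero    = ℤ.+-comm (f 0 * g 1) _
  ⊛-unfoldʳ f g (suc n) rewrite ⊛-unfoldʳ (f ∘ suc) g n =
    lemma (f 0 * g (suc (suc n))) (f (suc (suc n)) * g 0) _
    where
    lemma : ∀ a b c → a + (b + c) ≡ b + (a + c)
    lemma = solve-∀

  ⊛-comm : ∀ f g → f ⊛ g ≗ g ⊛ f
  ⊛-comm f g zero    = ℤ.*-comm (f 0) (g 0)
  ⊛-comm f g (suc n) = begin
    f 0 * g (suc n) + ((f ∘ suc) ⊛ g) n  ≡⟨ cong₂ _+_ (ℤ.*-comm (f 0) _) (⊛-comm (f ∘ suc) g n) ⟩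
    g (suc n) * f 0 + (g ⊛ (f ∘ suc)) n  ≡⟨ ⊛-unfoldʳ g f n ⟨
    (g ⊛ f) (suc n)                      ∎
    where open ≡-Reasoning

  0-⊛ : ∀ f n → ((λ _ → 0ℤ) ⊛ f) n ≡ 0ℤ
  0-⊛ f zero    = refl
  0-⊛ f (suc n) = trans (ℤ.+-identityˡ _) (0-⊛ f n)

  const-⊛ : ∀ c f n → (const c ⊛ f) n ≡ c * f n
  const-⊛ c f zero    = refl
  const-⊛ c f (suc n) = trans (cong (_+_ (c * f (suc n))) (0-⊛ f n)) (ℤ.+-identityʳ _)

  X-⊛-suc : ∀ f n → (X ⊛ f) (suc n) ≡ f n
  X-⊛-suc f n = trans (ℤ.+-identityˡ _) (trans (const-⊛ 1ℤ f n) (ℤ.*-identityˡ (f n)))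

  ⊛-identityˡ : ∀ f → const 1ℤ ⊛ f ≗ f
  ⊛-identityˡ f n = trans (const-⊛ 1ℤ f n) (ℤ.*-identityˡ (f n))

  const-0 : ∀ n → const 0ℤ n ≡ 0ℤ
  const-0 zero    = refl
  const-0 (suc _) = refl

  series-isCommutativeRing : IsCommutativeRing _≗_ _⊕_ _⊛_ ⊝_ (const 0ℤ) (const 1ℤ)
  series-isCommutativeRing = record
    { isRing = record
      { +-isAbelianGroup = record
        { isGroup = record
          { isMonoid = record
            { isSemigroup = record
              { isMagma = record
                { isEquivalence = record
                  { refl  = λ _ → refl
                  ; sym   = λ p n → sym (p n)
                  ; trans = λ p q n → trans (p n) (q n)
                  }
                ; ∙-cong = λ p q n → cong₂ _+_ (p n) (q n)
                }
              ; assoc = λ f g h n → ℤ.+-assoc (f n) (g n) (h n)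
              }
            ; identity = (λ f n → trans (cong (_+ f n) (const-0 n)) (ℤ.+-identityˡ (f n)))
                       , (λ f n → trans (cong (_+_ (f n)) (const-0 n)) (ℤ.+-identityʳ (f n)))
            }
          ; inverse = (λ f n → trans (ℤ.+-inverseˡ (f n)) (sym (const-0 n)))
                    , (λ f n → trans (ℤ.+-inverseʳ (f n)) (sym (const-0 n)))
          ; ⁻¹-cong = λ p n → cong -_ (p n)
          }
        ; comm = λ f g n → ℤ.+-comm (f n) (g n)
        }
      ; *-cong     = ⊛-cong
      ; *-assoc    = ⊛-assoc
      ; *-identity = ⊛-identityˡ
                   , (λ f n → trans (⊛-comm f (const 1ℤ) n) (⊛-identityˡ f n))
      ; distrib    = (λ f g h n → begin
                         (f ⊛ (g ⊕ h)) n    ≡⟨ ⊛-comm f (g ⊕ h) n ⟩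
                         ((g ⊕ h) ⊛ f) n    ≡⟨ ⊛-distribʳ-⊕ f g h n ⟩
                         (g ⊛ f ⊕ h ⊛ f) n  ≡⟨ cong₂ _+_ (⊛-comm g f n) (⊛-comm h f n) ⟩
                         (f ⊛ g ⊕ f ⊛ h) n  ∎)
                   , ⊛-distribʳ-⊕
      }
    ; *-comm = ⊛-comm
    }
    where open ≡-Reasoning

  series-commutativeRing : CommutativeRing 0ℓ 0ℓ
  series-commutativeRing = record { isCommutativeRing = series-isCommutativeRing }

  const-* : ∀ c d → const (c * d) ≗ const c ⊛ const d
  const-* c d zero    = refl
  const-* c d (suc n) = sym (trans (const-⊛ c (const d) (suc n)) (ℤ.*-zeroʳ c))

  -- Lets the ring solver compute with integer coefficients, whose equality is decidable, while the
  -- variables range over series.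
  const-morphism : CommutativeRing.rawRing ℤ.+-*-commutativeRing
                     -Raw-AlmostCommutative⟶ fromCommutativeRing series-commutativeRing
  const-morphism = record
    { ⟦_⟧    = const
    ; +-homo = λ { _ _ zero → refl ; _ _ (suc _) → refl }
    ; *-homo = const-*
    ; -‿homo = λ { _ zero → refl ; _ (suc _) → refl }
    ; 0-homo = λ _ → refl
    ; 1-homo = λ _ → refl
    }

  const-≟ : ∀ c d → Maybe (const c ≗ const d)
  const-≟ c d with c ℤ.≟ d
  ... | yes refl = just (λ _ → refl)
  ... | no  _    = nothing

  module SeriesSolver = RingSolver
    (CommutativeRing.rawRing ℤ.+-*-commutativeRing)
    (fromCommutativeRing series-commutativeRing)
    const-morphism const-≟

  open CommutativeRing series-commutativeRing using (semiring; commutativeSemiring)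
  open import Algebra.Properties.Semiring.Exp semiring using (_^_; ^-assocʳ; ^-congˡ)
  open import Algebra.Properties.CommutativeSemiring.Exp commutativeSemiring using (^-distrib-*)
  open SeriesSolver

  -- Congruences between integers

  infix 4 _≋_[_]

  -- A record, so that a, b and n can be inferred from the type.
  record _≋_[_] (a b n : ℤ) : Set where
    constructor mod
    field n∣a-b : n ∣ a - b

  open _≋_[_]

  module _ {n : ℤ} where

    ≋-reflexive : ∀ {a b} → a ≡ b → a ≋ b [ n ]
    ≋-reflexive {a} refl = mod (divides 0ℤ (ℤ.+-inverseʳ a))

    ≋-sym : ∀ {a b} → a ≋ b [ n ] → b ≋ a [ n ]
    ≋-sym {a} {b} (mod p) = mod (subst (n ∣_) (lemma a b) (∣m⇒∣-m p))
      where
      lemma : ∀ a b → - (a - b) ≡ b - a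
      lemma = solve-∀

    ≋-trans : ∀ {a b c} → a ≋ b [ n ] → b ≋ c [ n ] → a ≋ c [ n ]
    ≋-trans {a} {b} {c} (mod p) (mod q) =
      mod (subst (n ∣_) (lemma a b c) (∣m∣n⇒∣m+n p q))
      where
      lemma : ∀ a b c → a - b + (b - c) ≡ a - c
      lemma = solve-∀

    ≋-setoid : Setoid 0ℓ 0ℓ
    ≋-setoid = record
      { _≈_ = _≋_[ n ]
      ; isEquivalence = record
        { refl = ≋-reflexive refl ; sym = ≋-sym ; trans = ≋-trans }
      }

    ≋-+ : ∀ {a b c d} → a ≋ b [ n ] → c ≋ d [ n ] → a + c ≋ b + d [ n ]
    ≋-+ {a} {b} {c} {d} (mod p) (mod q) =
      mod (subst (n ∣_) (lemma a b c d) (∣m∣n⇒∣m+n p q))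
      where
      lemma : ∀ a b c d → a - b + (c - d) ≡ a + c - (b + d)
      lemma = solve-∀

    ≋-* : ∀ {a b c d} → a ≋ b [ n ] → c ≋ d [ n ] → a * c ≋ b * d [ n ]
    ≋-* {a} {b} {c} {d} (mod p) (mod q) =
      mod (subst (n ∣_) (lemma a b c d) (∣m∣n⇒∣m+n (∣m⇒∣m*n c p) (∣n⇒∣m*n b q)))
      where
      lemma : ∀ a b c d → (a - b) * c + b * (c - d) ≡ a * c - b * d
      lemma = solve-∀

    ≋-*ˡ : ∀ c {a b} → a ≋ b [ n ] → c * a ≋ c * b [ n ]
    ≋-*ˡ c = ≋-* (≋-reflexive {c} refl)

    ∣⇒≋0 : ∀ {a} → n ∣ a → a ≋ 0ℤ [ n ]
    ∣⇒≋0 {a} p = mod (subst (n ∣_) (sym (ℤ.+-identityʳ a)) p)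

    ≋0⇒∣ : ∀ {a} → a ≋ 0ℤ [ n ] → n ∣ a
    ≋0⇒∣ {a} (mod p) = subst (n ∣_) (ℤ.+-identityʳ a) p

  *-mono-∣ : ∀ {a b c d} → a ∣ b → c ∣ d → a * c ∣ b * d
  *-mono-∣ {a} {b} {c} {d} p q = ∣-trans (*-monoˡ-∣ c p) (*-monoʳ-∣ b q)

  -- The Euler operator x d/dx

  θ : Series → Series
  θ f n = + n * f n

  θ-⊛ : ∀ f g → θ (f ⊛ g) ≗ θ f ⊛ g ⊕ f ⊛ θ g
  θ-⊛ f g zero    = lemma (f 0) (g 0)
    where
    lemma : ∀ a b → 0ℤ * (a * b) ≡ 0ℤ * a * b + a * (0ℤ * b)
    lemma = solve-∀
  θ-⊛ f g (suc n) = begin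
    + suc n * (f 0 * g (suc n) + r)
      ≡⟨ expand (+ n) (f 0) (g (suc n)) r ⟩
    f 0 * (+ suc n * g (suc n)) + (+ n * r + r)
      ≡⟨ cong (λ s → f 0 * (+ suc n * g (suc n)) + (s + r)) (θ-⊛ (f ∘ suc) g n) ⟩
    f 0 * (+ suc n * g (suc n)) + ((θ (f ∘ suc) ⊛ g) n + r′ + r)
      ≡⟨ regroup (f 0) (f 0 * (+ suc n * g (suc n))) (g (suc n)) ((θ (f ∘ suc) ⊛ g) n) r r′ ⟩
    0ℤ * f 0 * g (suc n) + ((θ (f ∘ suc) ⊛ g) n + r) + (f 0 * (+ suc n * g (suc n)) + r′)
      ≡⟨ cong (λ s → 0ℤ * f 0 * g (suc n) + s + (f 0 * (+ suc n * g (suc n)) + r′)) θ-tail ⟩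
    (θ f ⊛ g ⊕ f ⊛ θ g) (suc n) ∎
    where
    open ≡-Reasoning
    r r′ : ℤ
    r  = ((f ∘ suc) ⊛ g) n
    r′ = ((f ∘ suc) ⊛ θ g) n
    expand : ∀ k a b c → (1ℤ + k) * (a * b + c) ≡ a * ((1ℤ + k) * b) + (k * c + c)
    expand = solve-∀
    regroup : ∀ a b c d e e′ → b + (d + e′ + e) ≡ 0ℤ * a * c + (d + e) + (b + e′)
    regroup = solve-∀
    suc-* : ∀ k a → k * a + a ≡ (1ℤ + k) * a
    suc-* = solve-∀
    -- Taking the tail before `θ` lowers every weight by one; the extra copy of `r` restores it.
    θ-tail : (θ (f ∘ suc) ⊛ g) n + r ≡ ((θ f ∘ suc) ⊛ g) n
    θ-tail = trans (sym (⊛-distribʳ-⊕ g (θ (f ∘ suc)) (f ∘ suc) n))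
      (⊛-cong {g = g} (λ k → suc-* (+ k) (f (suc k))) (λ _ → refl) n)

  -- The power rule multiplied through by f, so that no exponent n - 1 occurs and the induction can
  -- start at 0.
  ⊛-θ-^ : ∀ f n → f ⊛ θ (f ^ n) ≗ const (+ n) ⊛ (f ^ n ⊛ θ f)
  ⊛-θ-^ f zero    k = begin
    (f ⊛ θ (const 1ℤ)) k                     ≡⟨ ⊛-cong {f} (λ _ → refl) θ-1 k ⟩
    (f ⊛ const 0ℤ) k                         ≡⟨ zeros f (θ f) k ⟩
    (const 0ℤ ⊛ (const 1ℤ ⊛ θ f)) k          ∎
    where
    open ≡-Reasoning
    θ-1 : θ (const 1ℤ) ≗ const 0ℤ
    θ-1 zero    = refl
    θ-1 (suc n) = ℤ.*-zeroʳ (+ suc n)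
    zeros : ∀ a b → a ⊛ const 0ℤ ≗ const 0ℤ ⊛ (const 1ℤ ⊛ b)
    zeros = solve 2 (λ a b → a :* con 0ℤ := con 0ℤ :* (con 1ℤ :* b)) (λ _ → refl)
  ⊛-θ-^ f (suc n) k = begin
    (f ⊛ θ (f ⊛ f ^ n)) k
      ≡⟨ ⊛-cong {f} (λ _ → refl) (θ-⊛ f (f ^ n)) k ⟩
    (f ⊛ (θ f ⊛ f ^ n ⊕ f ⊛ θ (f ^ n))) k
      ≡⟨ ⊛-cong {f} (λ _ → refl) (λ j → cong (_+_ ((θ f ⊛ f ^ n) j)) (⊛-θ-^ f n j)) k ⟩
    (f ⊛ (θ f ⊛ f ^ n ⊕ const (+ n) ⊛ (f ^ n ⊛ θ f))) k
      ≡⟨ collect f (θ f) (f ^ n) (const (+ n)) k ⟩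
    ((const 1ℤ ⊕ const (+ n)) ⊛ (f ⊛ f ^ n ⊛ θ f)) k
      ≡⟨ ⊛-cong {g = f ⊛ f ^ n ⊛ θ f} (λ { zero → refl ; (suc _) → refl }) (λ _ → refl) k ⟩
    (const (+ suc n) ⊛ (f ⊛ f ^ n ⊛ θ f)) k ∎
    where
    open ≡-Reasoning
    collect : ∀ a b c d → a ⊛ (b ⊛ c ⊕ d ⊛ (c ⊛ b)) ≗ (const 1ℤ ⊕ d) ⊛ (a ⊛ c ⊛ b)
    collect = solve 4 (λ a b c d → a :* (b :* c :+ d :* (c :* b)) :=
                                   (con 1ℤ :+ d) :* (a :* c :* b)) (λ _ → refl)

  θ-^-suc : ∀ f n k → θ (f ^ suc n) k ≡ + suc n * (f ^ n ⊛ θ f) k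
  θ-^-suc f n k = begin
    θ (f ⊛ f ^ n) k
      ≡⟨ θ-⊛ f (f ^ n) k ⟩
    (θ f ⊛ f ^ n) k + (f ⊛ θ (f ^ n)) k
      ≡⟨ cong₂ _+_ (⊛-comm (θ f) (f ^ n) k) (trans (⊛-θ-^ f n k) (const-⊛ (+ n) _ k)) ⟩
    (f ^ n ⊛ θ f) k + + n * (f ^ n ⊛ θ f) k
      ≡⟨ lemma (+ n) _ ⟩
    + suc n * (f ^ n ⊛ θ f) k ∎
    where
    open ≡-Reasoning
    lemma : ∀ k a → a + k * a ≡ (1ℤ + k) * a
    lemma = solve-∀

  -- End terms and middle part of a coefficient of a product.

  ⊛-ends : ∀ f g n → (f ⊛ g) (2 ℕ.+ n) ≡
    f 0 * g (2 ℕ.+ n) + (f (2 ℕ.+ n) * g 0 + ((f ∘ suc) ⊛ (g ∘ suc)) n)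
  ⊛-ends f g n = cong (_+_ (f 0 * g (2 ℕ.+ n))) (⊛-unfoldʳ (f ∘ suc) g n)

  ⊛-∣ : ∀ {a b f g} n → (∀ k → k ℕ.≤ n → a ∣ f k) → (∀ k → k ℕ.≤ n → b ∣ g k) →
        a * b ∣ (f ⊛ g) n
  ⊛-∣ zero    a∣f b∣g = *-mono-∣ (a∣f 0 ℕ.≤-refl) (b∣g 0 ℕ.≤-refl)
  ⊛-∣ (suc n) a∣f b∣g = ∣m∣n⇒∣m+n
    (*-mono-∣ (a∣f 0 ℕ.z≤n) (b∣g (suc n) ℕ.≤-refl))
    (⊛-∣ n (λ k k≤n → a∣f (suc k) (ℕ.s≤s k≤n)) (λ k k≤n → b∣g k (ℕ.m≤n⇒m≤1+n k≤n)))

  -- Powers of linear series.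

  linear : ℤ → ℤ → Series
  linear a b = const a ⊕ const b ⊛ X

  linear-⊛-suc : ∀ a b f n → (linear a b ⊛ f) (suc n) ≡ a * f (suc n) + b * f n
  linear-⊛-suc a b f n = begin
    (linear a b ⊛ f) (suc n)
      ≡⟨ expand (const a) (const b) f X (suc n) ⟩
    (const a ⊛ f) (suc n) + (const b ⊛ (X ⊛ f)) (suc n)
      ≡⟨ cong₂ _+_ (const-⊛ a f (suc n)) (const-⊛ b (X ⊛ f) (suc n)) ⟩
    a * f (suc n) + b * (X ⊛ f) (suc n)
      ≡⟨ cong (λ r → a * f (suc n) + b * r) (X-⊛-suc f n) ⟩
    a * f (suc n) + b * f n ∎
    where
    open ≡-Reasoning
    expand : ∀ a b f x → (a ⊕ b ⊛ x) ⊛ f ≗ a ⊛ f ⊕ b ⊛ (x ⊛ f)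
    expand = solve 4 (λ a b f x → (a :+ b :* x) :* f := a :* f :+ b :* (x :* f)) (λ _ → refl)

  linear-⊛-zero : ∀ a b f → (linear a b ⊛ f) 0 ≡ a * f 0
  linear-⊛-zero a b f = lemma a b (f 0)
    where
    lemma : ∀ a b c → (a + b * 0ℤ) * c ≡ a * c
    lemma = solve-∀

  shift : ℤ → ℤ → Series → Series
  shift a b f n = a * f (suc n) + b * f n

  shift^ : ℤ → ℤ → ℕ → Series → Series
  shift^ a b zero    f = f
  shift^ a b (suc n) f = shift a b (shift^ a b n f)

  -- Read at indices n + k, multiplication by (a + bx)ⁿ is the n-th power of a shift operator;
  -- this replaces the binomial theorem.
  linear^-⊛ : ∀ a b n f k → (linear a b ^ n ⊛ f) (n ℕ.+ k) ≡ shift^ a b n f k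
  linear^-⊛ a b zero    f k = ⊛-identityˡ f k
  linear^-⊛ a b (suc n) f k = begin
    (linear a b ⊛ linear a b ^ n ⊛ f) (suc (n ℕ.+ k))
      ≡⟨ ⊛-assoc (linear a b) (linear a b ^ n) f (suc (n ℕ.+ k)) ⟩
    (linear a b ⊛ (linear a b ^ n ⊛ f)) (suc (n ℕ.+ k))
      ≡⟨ linear-⊛-suc a b (linear a b ^ n ⊛ f) (n ℕ.+ k) ⟩
    a * (linear a b ^ n ⊛ f) (suc (n ℕ.+ k)) + b * (linear a b ^ n ⊛ f) (n ℕ.+ k)
      ≡⟨ cong₂ (λ r s → a * r + b * s)
           (trans (cong (linear a b ^ n ⊛ f) (sym (ℕ.+-suc n k))) (linear^-⊛ a b n f (suc k)))
           (linear^-⊛ a b n f k) ⟩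
    shift^ a b (suc n) f k ∎
    where open ≡-Reasoning

  ^-zero : ∀ f n → (f ^ n) 0 ≡ f 0 ℤ.^ n
  ^-zero f zero    = refl
  ^-zero f (suc n) = cong (f 0 *_) (^-zero f n)

  linear^-top : ∀ a b n → (linear a b ^ n) n ≡ b ℤ.^ n
  linear^-top a b n = begin
    (linear a b ^ n) n                     ≡⟨ ⊛-identityˡ (linear a b ^ n) n ⟨
    (const 1ℤ ⊛ linear a b ^ n) n          ≡⟨ ⊛-comm (const 1ℤ) (linear a b ^ n) n ⟩
    (linear a b ^ n ⊛ const 1ℤ) n          ≡⟨ cong (linear a b ^ n ⊛ const 1ℤ) (ℕ.+-identityʳ n) ⟨
    (linear a b ^ n ⊛ const 1ℤ) (n ℕ.+ 0)  ≡⟨ linear^-⊛ a b n (const 1ℤ) 0 ⟩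
    shift^ a b n (const 1ℤ) 0              ≡⟨ shift^-const n 0 ⟩
    b ℤ.^ n ∎
    where
    open ≡-Reasoning
    -- A shift at k also reads k + 1, so the induction needs the value at every index and not only
    -- at 0.
    shift^-const : ∀ n k → shift^ a b n (const 1ℤ) k ≡ const (b ℤ.^ n) k
    shift^-const zero    k       = refl
    shift^-const (suc n) zero    rewrite shift^-const n 1 | shift^-const n 0 | ℤ.*-zeroʳ a =
      ℤ.+-identityˡ _
    shift^-const (suc n) (suc k) rewrite shift^-const n (2 ℕ.+ k) | shift^-const n (suc k) | ℤ.*-zeroʳ a =
      trans (ℤ.+-identityˡ _) (ℤ.*-zeroʳ b)

  -- Middle coefficients of p-th powers.

  prime-cancel : ∀ {p k z} → Prime p → ¬ (p ℕ.∣ k) → + p ∣ + k * z → + p ∣ z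
  prime-cancel {p} {k} {z} p-prime p∤k p∣kz
    with euclidsLemma k ∣ z ∣ p-prime (subst (p ℕ.∣_) (ℤ.abs-* (+ k) z) (∣⇒∣ᵤ p∣kz))
  ... | inj₁ p∣k = contradiction p∣k p∤k
  ... | inj₂ p∣z = ∣ᵤ⇒∣ p∣z

  -- Multiplied by k + 1, the coefficient becomes a multiple of p by the power rule, and 0 < k + 1 <
  -- p makes this factor cancellable.
  prime∣^ : ∀ {p} → Prime p → ∀ f k → suc k ℕ.< p → + p ∣ (f ^ p) (suc k)
  prime∣^ {suc p-1} p-prime f k k<p =
    prime-cancel p-prime (ℕ.>⇒∤ k<p)
      (subst (+ suc p-1 ∣_) (sym (θ-^-suc f p-1 (suc k))) (∣m⇒∣m*n _ ∣-refl))

  1∣ : ∀ {a} → 1ℤ ∣ a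
  1∣ {a} = divides a (sym (ℤ.*-identityʳ a))

  -- Every term of the middle part is a multiple of a times a multiple of b. Taking a = b = p gives
  -- congruences modulo p², taking b = 1 gives them modulo p.
  ⊛-ends-≋ : ∀ {a b} f g n →
    (∀ k → k ℕ.≤ n → a ∣ f (suc k)) → (∀ k → k ℕ.≤ n → b ∣ g (suc k)) →
    (f ⊛ g) (2 ℕ.+ n) ≋ f 0 * g (2 ℕ.+ n) + f (2 ℕ.+ n) * g 0 [ a * b ]
  ⊛-ends-≋ {a} {b} f g n a∣f b∣g = mod (subst (a * b ∣_)
    (trans (lemma (f 0 * g (2 ℕ.+ n)) (f (2 ℕ.+ n) * g 0) _)
           (cong (_- (f 0 * g (2 ℕ.+ n) + f (2 ℕ.+ n) * g 0)) (sym (⊛-ends f g n))))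
    (⊛-∣ n a∣f b∣g))
    where
    lemma : ∀ s t r → r ≡ s + (t + r) - (s + t)
    lemma = solve-∀

  -- u n + i v n = (1 + i)ⁿ and re n + i im n = iⁿ

  u v : ℕ → ℤ
  u zero    = 1ℤ
  u (suc n) = u n - v n
  v zero    = 0ℤ
  v (suc n) = u n + v n

  re im : ℕ → ℤ
  re zero    = 1ℤ
  re (suc n) = - im n
  im zero    = 0ℤ
  im (suc n) = re n

  -- With E f k = f (k + 1), the sequence iᵏ is an eigenvector of E + 1 with eigenvalue 1 + i, so n
  -- applications give (1 + i)ⁿ iᵏ. This is the real part, `shift^-im` the imaginary part.
  shift^-re : ∀ n k → shift^ 1ℤ 1ℤ n re k ≡ u n * re k - v n * im k
  shift^-re zero    k = lemma (re k) (im k)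
    where
    lemma : ∀ a b → a ≡ 1ℤ * a - 0ℤ * b
    lemma = solve-∀
  shift^-re (suc n) k rewrite shift^-re n (suc k) | shift^-re n k =
    lemma (u n) (v n) (re k) (im k)
    where
    lemma : ∀ a b c d → 1ℤ * (a * (- d) - b * c) + 1ℤ * (a * c - b * d) ≡ (a - b) * c - (a + b) * d
    lemma = solve-∀

  shift^-im : ∀ n k → shift^ 1ℤ 1ℤ n im k ≡ u n * im k + v n * re k
  shift^-im zero    k = lemma (re k) (im k)
    where
    lemma : ∀ a b → b ≡ 1ℤ * b + 0ℤ * a
    lemma = solve-∀
  shift^-im (suc n) k rewrite shift^-im n (suc k) | shift^-im n k =
    lemma (u n) (v n) (re k) (im k)
    where
    lemma : ∀ a b c d → 1ℤ * (a * c + b * (- d)) + 1ℤ * (a * d + b * c) ≡ (a - b) * d + (a + b) * c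
    lemma = solve-∀

  -- The operator form of (E + 1)ᵖ ≡ Eᵖ + 1: only the end terms of (1 + x)ᵖ survive modulo p.
  shift^-prime : ∀ {p} → Prime p → ∀ f → shift^ 1ℤ 1ℤ p f 0 ≋ f p + f 0 [ + p ]
  shift^-prime {p@(2+ n)} p-prime f = begin
    shift^ 1ℤ 1ℤ p f 0                ≡⟨ linear^-⊛ 1ℤ 1ℤ p f 0 ⟨
    (1+X ^ p ⊛ f) (p ℕ.+ 0)           ≡⟨ cong (1+X ^ p ⊛ f) (ℕ.+-identityʳ p) ⟩
    (1+X ^ p ⊛ f) p                   ≈⟨ ends ⟩
    (1+X ^ p) 0 * f p + (1+X ^ p) p * f 0
      ≡⟨ cong₂ (λ r s → r * f p + s * f 0)
           (trans (^-zero 1+X p) (ℤ.^-zeroˡ p)) (trans (linear^-top 1ℤ 1ℤ p) (ℤ.^-zeroˡ p)) ⟩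
    1ℤ * f p + 1ℤ * f 0               ≡⟨ cong₂ _+_ (ℤ.*-identityˡ (f p)) (ℤ.*-identityˡ (f 0)) ⟩
    f p + f 0 ∎
    where
    open import Relation.Binary.Reasoning.Setoid (≋-setoid {+ p})
    1+X : Series
    1+X = linear 1ℤ 1ℤ
    ends : (1+X ^ p ⊛ f) p ≋ (1+X ^ p) 0 * f p + (1+X ^ p) p * f 0 [ + p ]
    ends = subst ((1+X ^ p ⊛ f) p ≋ (1+X ^ p) 0 * f p + (1+X ^ p) p * f 0 [_]) (ℤ.*-identityʳ (+ p))
      (⊛-ends-≋ {b = 1ℤ} (1+X ^ p) f n
        (λ k k≤n → prime∣^ p-prime 1+X k (ℕ.s≤s (ℕ.s≤s k≤n))) (λ _ _ → 1∣))

  u-shift : ∀ n → shift^ 1ℤ 1ℤ n re 0 ≡ u n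
  u-shift n = trans (shift^-re n 0) (lemma (u n) (v n))
    where
    lemma : ∀ a b → a * 1ℤ - b * 0ℤ ≡ a
    lemma = solve-∀

  v-shift : ∀ n → shift^ 1ℤ 1ℤ n im 0 ≡ v n
  v-shift n = trans (shift^-im n 0) (lemma (u n) (v n))
    where
    lemma : ∀ a b → a * 0ℤ + b * 1ℤ ≡ b
    lemma = solve-∀

  re-odd : ∀ j → re (suc (j ℕ.* 2)) ≡ 0ℤ
  re-odd zero    = refl
  re-odd (suc j) = cong -_ (re-odd j)

  im-odd : ∀ j → im (suc (j ℕ.* 2)) ≡ -1ℤ ℤ.^ j
  im-odd zero    = refl
  im-odd (suc j) = trans (cong -_ (im-odd j)) (sym (ℤ.-1*i≡-i _))

  -- The real part of (1 + i)ᵖ ≡ iᵖ + 1; as p is odd, iᵖ is imaginary. For p = 2j + 1 the imaginary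
  -- part in `v-prime` is (-1)ʲ.
  u-prime : ∀ j → Prime (suc (j ℕ.* 2)) → u (suc (j ℕ.* 2)) ≋ 1ℤ [ + suc (j ℕ.* 2) ]
  u-prime j p-prime = subst₂ _≋_[ + p ] (u-shift p) (cong (_+ 1ℤ) (re-odd j)) (shift^-prime p-prime re)
    where
    p = suc (j ℕ.* 2)

  v-prime : ∀ j → Prime (suc (j ℕ.* 2)) → v (suc (j ℕ.* 2)) ≋ -1ℤ ℤ.^ j [ + suc (j ℕ.* 2) ]
  v-prime j p-prime = subst₂ _≋_[ + p ] (v-shift p)
    (trans (ℤ.+-identityʳ _) (im-odd j)) (shift^-prime p-prime im)
    where
    p = suc (j ℕ.* 2)

  -- For odd n the argument of (1 + i)ⁿ is an odd multiple of π/4, so real and imaginary part each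
  -- contribute half of the norm 2ⁿ.
  2u²≡2^ : ∀ j → + 2 * (u (suc (j ℕ.* 2)) * u (suc (j ℕ.* 2))) ≡ (+ 2) ℤ.^ suc (j ℕ.* 2)
  2u²≡2^ j = proj₁ (both j)
    where
    lemma : ∀ a b c → + 2 * (b * b) ≡ c →
      + 2 * ((a - b - (a + b)) * (a - b - (a + b))) ≡ + 2 * (+ 2 * c)
    lemma a b _ refl = solved a b
      where
      solved : ∀ a b → + 2 * ((a - b - (a + b)) * (a - b - (a + b))) ≡ + 2 * (+ 2 * (+ 2 * (b * b)))
      solved = solve-∀
    lemma′ : ∀ a b c → + 2 * (a * a) ≡ c →
      + 2 * ((a - b + (a + b)) * (a - b + (a + b))) ≡ + 2 * (+ 2 * c)
    lemma′ a b _ refl = solved a b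
      where
      solved : ∀ a b → + 2 * ((a - b + (a + b)) * (a - b + (a + b))) ≡ + 2 * (+ 2 * (+ 2 * (a * a)))
      solved = solve-∀
    -- Multiplication by (1 + i)² = 2i exchanges the two parts up to sign and a factor 2, so both
    -- squares go through the induction together.
    both : ∀ j → let n = suc (j ℕ.* 2) in
      + 2 * (u n * u n) ≡ (+ 2) ℤ.^ n × + 2 * (v n * v n) ≡ (+ 2) ℤ.^ n
    both zero    = refl , refl
    both (suc j) with both j
    ... | eqᵤ , eqᵥ = lemma (u n) (v n) _ eqᵥ , lemma′ (u n) (v n) _ eqᵤ
      where n = suc (j ℕ.* 2)

  θ-linear : ∀ a b → θ (linear a b) ≗ const b ⊛ X
  θ-linear a b zero    = sym (ℤ.*-zeroʳ b)
  θ-linear a b (suc k) = begin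
    + suc k * (0ℤ + (const b ⊛ X) (suc k))
      ≡⟨ cong (_*_ (+ suc k)) (trans (ℤ.+-identityˡ _) (const-⊛ b X (suc k))) ⟩
    + suc k * (b * const 1ℤ k)               ≡⟨ lemma k ⟩
    b * const 1ℤ k                           ≡⟨ const-⊛ b X (suc k) ⟨
    (const b ⊛ X) (suc k) ∎
    where
    open ≡-Reasoning
    lemma : ∀ k → + suc k * (b * const 1ℤ k) ≡ b * const 1ℤ k
    lemma zero    = ℤ.*-identityˡ (b * 1ℤ)
    lemma (suc k) rewrite ℤ.*-zeroʳ b = ℤ.*-zeroʳ (+ suc (suc k))

  binomial-coefficient : ∀ n k → (linear 1ℤ 1ℤ ^ n) k ≡ + (n C k)
  binomial-coefficient zero    zero    = refl
  binomial-coefficient zero    (suc k) = refl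
  binomial-coefficient (suc n) zero    =
    trans (linear-⊛-zero 1ℤ 1ℤ (linear 1ℤ 1ℤ ^ n))
      (trans (ℤ.*-identityˡ _) (binomial-coefficient n zero))
  binomial-coefficient (suc n) (suc k) = begin
    (linear 1ℤ 1ℤ ^ suc n) (suc k)
      ≡⟨ linear-⊛-suc 1ℤ 1ℤ (linear 1ℤ 1ℤ ^ n) k ⟩
    1ℤ * (linear 1ℤ 1ℤ ^ n) (suc k) + 1ℤ * (linear 1ℤ 1ℤ ^ n) k
      ≡⟨ cong₂ (λ r s → 1ℤ * r + 1ℤ * s) (binomial-coefficient n (suc k)) (binomial-coefficient n k) ⟩
    1ℤ * + (n C suc k) + 1ℤ * + (n C k)
      ≡⟨ lemma (+ (n C suc k)) (+ (n C k)) ⟩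
    + (n C k ℕ.+ n C suc k)
      ≡⟨ cong +_ (nCk+nC[k+1]≡[n+1]C[k+1] n k) ⟩
    + (suc n C suc k) ∎
    where
    open ≡-Reasoning
    lemma : ∀ a b → 1ℤ * a + 1ℤ * b ≡ b + a
    lemma = solve-∀

  -- The whole proof rests on the factorisation 2(1+x)³ - x = (2+x)(1+2x+2x²).
  cubic quad : Series
  cubic = const (+ 2) ⊛ linear 1ℤ 1ℤ ^ 3
  quad = const 1ℤ ⊕ const (+ 2) ⊛ X ⊕ const (+ 2) ⊛ X ^ 2

  cubic-X : cubic ⊕ ⊝ X ≗ linear (+ 2) 1ℤ ⊛ quad
  cubic-X = solve 1
    (λ x → con (+ 2) :* (con 1ℤ :+ con 1ℤ :* x) :^ 3 :+ :- x :=
           (con (+ 2) :+ con 1ℤ :* x) :* (con 1ℤ :+ con (+ 2) :* x :+ con (+ 2) :* x :^ 2))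
    (λ _ → refl) X

  -- The Horner form, from which coefficients are read off by `X-⊛-suc` alone.
  quad-⊛ : ∀ f → quad ⊛ f ≗ f ⊕ const (+ 2) ⊛ (X ⊛ (f ⊕ X ⊛ f))
  quad-⊛ f = solve 2
    (λ x f → (con 1ℤ :+ con (+ 2) :* x :+ con (+ 2) :* x :^ 2) :* f :=
             f :+ con (+ 2) :* (x :* (f :+ x :* f)))
    (λ _ → refl) X f

  quad-⊛-one : ∀ f → (quad ⊛ f) 1 ≡ f 1 + + 2 * f 0
  quad-⊛-one f = trans (quad-⊛ f 1) (cong (_+_ (f 1))
    (trans (const-⊛ (+ 2) (X ⊛ (f ⊕ X ⊛ f)) 1)
    (cong (_*_ (+ 2)) (trans (X-⊛-suc (f ⊕ X ⊛ f) 0) (ℤ.+-identityʳ (f 0))))))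

  quad-⊛-suc² : ∀ f n → (quad ⊛ f) (2 ℕ.+ n) ≡ f (2 ℕ.+ n) + + 2 * (f (suc n) + f n)
  quad-⊛-suc² f n = trans (quad-⊛ f (2 ℕ.+ n)) (cong (_+_ (f (2 ℕ.+ n)))
    (trans (const-⊛ (+ 2) (X ⊛ (f ⊕ X ⊛ f)) (2 ℕ.+ n))
    (cong (_*_ (+ 2)) (trans (X-⊛-suc (f ⊕ X ⊛ f) (suc n)) (cong (_+_ (f (suc n))) (X-⊛-suc f n))))))

  -- A k = 2ᵏ C_k⁽²⁾, in the form 2ᵏ (C(3k,k) - 2 C(3k,k-1)), and B k = 2ᵏ C(3k,k).
  A B : ℕ → ℤ
  A k = (linear 1ℤ (- + 2) ⊛ cubic ^ k) k
  B k = (cubic ^ k) k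

  -- Coefficients of powers of `cubic` and the Catalan numbers of order 2.

  const-^ : ∀ c n → const c ^ n ≗ const (c ℤ.^ n)
  const-^ c zero    k = refl
  const-^ c (suc n) k = trans (⊛-cong {const c} (λ _ → refl) (const-^ c n) k) (sym (const-* c (c ℤ.^ n) k))

  const-⊛-^ : ∀ c f n k → ((const c ⊛ f) ^ n) k ≡ c ℤ.^ n * (f ^ n) k
  const-⊛-^ c f n k = trans (^-distrib-* (const c) f n k)
    (trans (⊛-cong {g = f ^ n} (const-^ c n) (λ _ → refl) k) (const-⊛ (c ℤ.^ n) (f ^ n) k))

  cubic^-coefficient : ∀ n k → (cubic ^ n) k ≡ (+ 2) ℤ.^ n * + ((3 ℕ.* n) C k)
  cubic^-coefficient n k = trans (const-⊛-^ (+ 2) (linear 1ℤ 1ℤ ^ 3) n k)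
    (cong (_*_ ((+ 2) ℤ.^ n)) (trans (^-assocʳ (linear 1ℤ 1ℤ) 3 n k) (binomial-coefficient (3 ℕ.* n) k)))

  -- Compare the coefficients of xᵏ⁺¹ in (1 + x) θF = n x F, the differential equation of F = (1 +
  -- x)ⁿ.
  binomial-ratio : ∀ n k → + suc k * + (n C suc k) ≡ (+ n - + k) * + (n C k)
  binomial-ratio n k = move (+ suc k * + (n C suc k)) (+ k) (+ n) (+ (n C k)) (begin
    + suc k * + (n C suc k) + + k * + (n C k)
      ≡⟨ cong₂ (λ r s → + suc k * r + + k * s) (binomial-coefficient n (suc k)) (binomial-coefficient n k) ⟨
    θ F (suc k) + θ F k
      ≡⟨ unit (θ F (suc k)) (θ F k) ⟨
    1ℤ * θ F (suc k) + 1ℤ * θ F k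
      ≡⟨ linear-⊛-suc 1ℤ 1ℤ (θ F) k ⟨
    (linear 1ℤ 1ℤ ⊛ θ F) (suc k)
      ≡⟨ ⊛-θ-^ (linear 1ℤ 1ℤ) n (suc k) ⟩
    (const (+ n) ⊛ (F ⊛ θ (linear 1ℤ 1ℤ))) (suc k)
      ≡⟨ const-⊛ (+ n) (F ⊛ θ (linear 1ℤ 1ℤ)) (suc k) ⟩
    + n * (F ⊛ θ (linear 1ℤ 1ℤ)) (suc k)
      ≡⟨ cong (_*_ (+ n)) (⊛-comm F (θ (linear 1ℤ 1ℤ)) (suc k)) ⟩
    + n * (θ (linear 1ℤ 1ℤ) ⊛ F) (suc k)
      ≡⟨ cong (_*_ (+ n)) (⊛-cong {g = F} (λ j → trans (θ-linear 1ℤ 1ℤ j) (⊛-identityˡ X j)) (λ _ → refl) (suc k)) ⟩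
    + n * (X ⊛ F) (suc k)
      ≡⟨ cong (_*_ (+ n)) (trans (X-⊛-suc F k) (binomial-coefficient n k)) ⟩
    + n * + (n C k) ∎)
    where
    open ≡-Reasoning
    F : Series
    F = linear 1ℤ 1ℤ ^ n
    unit : ∀ a b → 1ℤ * a + 1ℤ * b ≡ a + b
    unit = solve-∀
    move : ∀ a b c d → a + b * d ≡ c * d → a ≡ (c - b) * d
    move a b c d eq = trans (lemma₁ a b d) (trans (cong (_- b * d) eq) (lemma₂ b c d))
      where
      lemma₁ : ∀ a b d → a ≡ a + b * d - b * d
      lemma₁ = solve-∀
      lemma₂ : ∀ b c d → c * d - b * d ≡ (c - b) * d
      lemma₂ = solve-∀

  -- For K = k + 1, `binomial-ratio` gives K C(3K,K) = (2K+1) C(3K,K-1), hence (2K+1) (C(3K,K) - 2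
  -- C(3K,K-1)) = C(3K,K).
  [2k+1]A≡B : ∀ k → + suc (2 ℕ.* k) * A k ≡ B k
  [2k+1]A≡B zero    = refl
  [2k+1]A≡B (suc k) = begin
    + suc (2 ℕ.* K) * A K
      ≡⟨ cong (+ suc (2 ℕ.* K) *_) (linear-⊛-suc 1ℤ (- + 2) (cubic ^ K) k) ⟩
    + suc (2 ℕ.* K) * (1ℤ * (cubic ^ K) K + - + 2 * (cubic ^ K) k)
      ≡⟨ cong₂ (λ r s → + suc (2 ℕ.* K) * (1ℤ * r + - + 2 * s)) (cubic^-coefficient K K) (cubic^-coefficient K k) ⟩
    + suc (2 ℕ.* K) * (1ℤ * (t * c′) + - + 2 * (t * c))
      ≡⟨ cong (λ r → r * (1ℤ * (t * c′) + - + 2 * (t * c))) cast₁ ⟩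
    (1ℤ + + 2 * + K) * (1ℤ * (t * c′) + - + 2 * (t * c))
      ≡⟨ lemma (+ k) t c c′ (trans (binomial-ratio (3 ℕ.* K) k) (cong (λ r → (r - + k) * c) (ℤ.pos-* 3 K))) ⟩
    t * c′
      ≡⟨ cubic^-coefficient K K ⟨
    B K ∎
    where
    open ≡-Reasoning
    K = suc k
    t c c′ : ℤ
    t  = (+ 2) ℤ.^ K
    c  = + ((3 ℕ.* K) C k)
    c′ = + ((3 ℕ.* K) C K)
    cast₁ : + suc (2 ℕ.* K) ≡ 1ℤ + + 2 * + K
    cast₁ = cong (_+_ 1ℤ) (ℤ.pos-* 2 K)
    lemma : ∀ k t c c′ → (1ℤ + k) * c′ ≡ (+ 3 * (1ℤ + k) - k) * c →
      (1ℤ + + 2 * (1ℤ + k)) * (1ℤ * (t * c′) + - + 2 * (t * c)) ≡ t * c′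
    lemma k t c c′ eq = trans (lemma₁ k t c c′)
      (trans (cong (λ r → t * c′ + + 2 * t * (r - (+ 3 + + 2 * k) * c)) eq) (lemma₂ k t c c′))
      where
      lemma₁ : ∀ k t c c′ → (1ℤ + + 2 * (1ℤ + k)) * (1ℤ * (t * c′) + - + 2 * (t * c)) ≡
        t * c′ + + 2 * t * ((1ℤ + k) * c′ - (+ 3 + + 2 * k) * c)
      lemma₁ = solve-∀
      lemma₂ : ∀ k t c c′ → t * c′ + + 2 * t * ((+ 3 * (1ℤ + k) - k) * c - (+ 3 + + 2 * k) * c) ≡ t * c′
      lemma₂ = solve-∀

  -- Σ_{k<n} xⁿ⁻¹⁻ᵏ (2(1+x)³)ᵏ
  geometric : ℕ → Series
  geometric zero    = const 0ℤ
  geometric (suc n) = X ⊛ geometric n ⊕ cubic ^ n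

  cubic-X-⊛-geometric : ∀ n → (cubic ⊕ ⊝ X) ⊛ geometric n ≗ cubic ^ n ⊕ ⊝ X ^ n
  cubic-X-⊛-geometric zero    =
    solve 2 (λ g x → (g :+ :- x) :* con 0ℤ := con 1ℤ :+ :- con 1ℤ) (λ _ → refl) cubic X
  cubic-X-⊛-geometric (suc n) k = begin
    ((cubic ⊕ ⊝ X) ⊛ (X ⊛ geometric n ⊕ cubic ^ n)) k
      ≡⟨ expand cubic X (geometric n) (cubic ^ n) k ⟩
    (X ⊛ ((cubic ⊕ ⊝ X) ⊛ geometric n) ⊕ (cubic ⊕ ⊝ X) ⊛ cubic ^ n) k
      ≡⟨ cong (_+ ((cubic ⊕ ⊝ X) ⊛ cubic ^ n) k) (⊛-cong {X} (λ _ → refl) (cubic-X-⊛-geometric n) k) ⟩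
    (X ⊛ (cubic ^ n ⊕ ⊝ X ^ n) ⊕ (cubic ⊕ ⊝ X) ⊛ cubic ^ n) k
      ≡⟨ collect cubic X (cubic ^ n) (X ^ n) k ⟩
    (cubic ⊛ cubic ^ n ⊕ ⊝ (X ⊛ X ^ n)) k ∎
    where
    open ≡-Reasoning
    expand : ∀ g x s t → (g ⊕ ⊝ x) ⊛ (x ⊛ s ⊕ t) ≗ x ⊛ ((g ⊕ ⊝ x) ⊛ s) ⊕ (g ⊕ ⊝ x) ⊛ t
    expand = solve 4
      (λ g x s t → (g :+ :- x) :* (x :* s :+ t) := x :* ((g :+ :- x) :* s) :+ (g :+ :- x) :* t)
      (λ _ → refl)
    collect : ∀ g x s t → x ⊛ (s ⊕ ⊝ t) ⊕ (g ⊕ ⊝ x) ⊛ s ≗ g ⊛ s ⊕ ⊝ (x ⊛ t)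
    collect = solve 4
      (λ g x s t → x :* (s :+ :- t) :+ (g :+ :- x) :* s := g :* s :+ :- (x :* t))
      (λ _ → refl)

  ∑-last : ∀ (f : ℕ → ℤ) n → ∑[ i < suc n ] f (toℕ i) ≡ ∑[ i < n ] f (toℕ i) + f n
  ∑-last f zero    = ℤ.+-comm (f 0) 0ℤ
  ∑-last f (suc n) = trans (cong (_+_ (f 0)) (∑-last (f ∘ suc) n)) (sym (ℤ.+-assoc (f 0) _ (f (suc n))))

  -- In [xⁿ], the factor xⁿ⁻ᵏ of the k-th summand of the geometric series leaves [xᵏ] (1-2x) gᵏ,
  -- which is `A k`.
  ∑-A : ∀ n → (linear 1ℤ (- + 2) ⊛ geometric (suc n)) n ≡ ∑[ i < suc n ] A (toℕ i)
  ∑-A zero    = refl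
  ∑-A (suc n) = begin
    (l ⊛ (X ⊛ geometric (suc n) ⊕ cubic ^ suc n)) (suc n)
      ≡⟨ expand l X (geometric (suc n)) (cubic ^ suc n) (suc n) ⟩
    (X ⊛ (l ⊛ geometric (suc n))) (suc n) + A (suc n)
      ≡⟨ cong (_+ A (suc n)) (trans (X-⊛-suc (l ⊛ geometric (suc n)) n) (∑-A n)) ⟩
    ∑[ i < suc n ] A (toℕ i) + A (suc n)
      ≡⟨ ∑-last A (suc n) ⟨
    ∑[ i < suc (suc n) ] A (toℕ i) ∎
    where
    open ≡-Reasoning
    l : Series
    l = linear 1ℤ (- + 2)
    expand : ∀ l x s t → l ⊛ (x ⊛ s ⊕ t) ≗ x ⊛ (l ⊛ s) ⊕ l ⊛ t
    expand = solve 4 (λ l x s t → l :* (x :* s :+ t) := x :* (l :* s) :+ l :* t) (λ _ → refl)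

  -2^ : ∀ j → (- + 2) ℤ.^ suc (j ℕ.* 2) ≡ - (+ 2) ℤ.^ suc (j ℕ.* 2)
  -2^ zero    = refl
  -2^ (suc j) rewrite -2^ j = lemma ((+ 2) ℤ.^ suc (j ℕ.* 2))
    where
    lemma : ∀ t → - + 2 * (- + 2 * (- t)) ≡ - (+ 2 * (+ 2 * t))
    lemma = solve-∀

  -1^ : ∀ j → -1ℤ ℤ.^ suc (j ℕ.* 2) ≡ -1ℤ
  -1^ zero    = refl
  -1^ (suc j) rewrite -1^ j = refl

  -- The coefficient of xⁿ in (g - x)ⁿ, where g is `cubic`.

  -- A factor g takes its share of the index by raising the exponent k of gᵏ, a factor x merely
  -- lowers the index. So g - x acts on the sequence `B` as the forward difference.
  cubic-X^-⊛ : ∀ n k → ((cubic ⊕ ⊝ X) ^ n ⊛ cubic ^ k) (n ℕ.+ k) ≡ shift^ 1ℤ -1ℤ n B k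
  cubic-X^-⊛ zero    k = ⊛-identityˡ (cubic ^ k) k
  cubic-X^-⊛ (suc n) k = begin
    ((cubic ⊕ ⊝ X) ⊛ D ⊛ cubic ^ k) (suc (n ℕ.+ k))
      ≡⟨ expand cubic X D (cubic ^ k) (suc (n ℕ.+ k)) ⟩
    (D ⊛ cubic ^ suc k) (suc (n ℕ.+ k)) - (X ⊛ (D ⊛ cubic ^ k)) (suc (n ℕ.+ k))
      ≡⟨ cong₂ _-_ (trans (cong (D ⊛ cubic ^ suc k) (sym (ℕ.+-suc n k))) (cubic-X^-⊛ n (suc k)))
                   (trans (X-⊛-suc (D ⊛ cubic ^ k) (n ℕ.+ k)) (cubic-X^-⊛ n k)) ⟩
    shift^ 1ℤ -1ℤ n B (suc k) - shift^ 1ℤ -1ℤ n B k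
      ≡⟨ lemma (shift^ 1ℤ -1ℤ n B (suc k)) (shift^ 1ℤ -1ℤ n B k) ⟩
    shift^ 1ℤ -1ℤ (suc n) B k ∎
    where
    open ≡-Reasoning
    D : Series
    D = (cubic ⊕ ⊝ X) ^ n
    expand : ∀ g x d s → (g ⊕ ⊝ x) ⊛ d ⊛ s ≗ d ⊛ (g ⊛ s) ⊕ ⊝ (x ⊛ (d ⊛ s))
    expand = solve 4
      (λ g x d s → (g :+ :- x) :* d :* s := d :* (g :* s) :+ :- (x :* (d :* s)))
      (λ _ → refl)
    lemma : ∀ a b → a - b ≡ 1ℤ * a + -1ℤ * b
    lemma = solve-∀

  -- Both sides are the n-th forward difference of `B` at 0.
  cubic-X^ : ∀ n → ((cubic ⊕ ⊝ X) ^ n) n ≡ (linear 1ℤ -1ℤ ^ n ⊛ B) n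
  cubic-X^ n = begin
    D n                             ≡⟨ trans (⊛-comm D (const 1ℤ) n) (⊛-identityˡ D n) ⟨
    (D ⊛ const 1ℤ) n                ≡⟨ cong (D ⊛ const 1ℤ) (ℕ.+-identityʳ n) ⟨
    (D ⊛ const 1ℤ) (n ℕ.+ 0)        ≡⟨ cubic-X^-⊛ n 0 ⟩
    shift^ 1ℤ -1ℤ n B 0             ≡⟨ linear^-⊛ 1ℤ -1ℤ n B 0 ⟨
    (linear 1ℤ -1ℤ ^ n ⊛ B) (n ℕ.+ 0)  ≡⟨ cong (linear 1ℤ -1ℤ ^ n ⊛ B) (ℕ.+-identityʳ n) ⟩
    (linear 1ℤ -1ℤ ^ n ⊛ B) n ∎
    where
    open ≡-Reasoning
    D : Series
    D = (cubic ⊕ ⊝ X) ^ n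

  -- (1 + (1 - i) x)ⁿ = U n + i V n
  U V : ℕ → Series
  U n k = + (n C k) * u k
  V n k = - (+ (n C k) * v k)

  pascal : ∀ n k → + (suc n C suc k) ≡ + (n C k) + + (n C suc k)
  pascal n k = cong +_ (sym (nCk+nC[k+1]≡[n+1]C[k+1] n k))

  -- The real part of multiplication by 1 + (1 - i) x; `V-suc` is the imaginary part.
  U-suc : ∀ n → U (suc n) ≗ U n ⊕ X ⊛ (U n ⊕ V n)
  U-suc n zero    = refl
  U-suc n (suc k) = trans (cong (_* u (suc k)) (pascal n k))
    (trans (lemma (+ (n C k)) (+ (n C suc k)) (u k) (v k)) (cong (_+_ (U n (suc k))) (sym (X-⊛-suc (U n ⊕ V n) k))))
    where
    lemma : ∀ a b c d → (a + b) * (c - d) ≡ b * (c - d) + (a * c + - (a * d))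
    lemma = solve-∀

  V-suc : ∀ n → V (suc n) ≗ V n ⊕ X ⊛ (V n ⊕ ⊝ U n)
  V-suc n zero    = refl
  V-suc n (suc k) = trans (cong (λ r → - (r * v (suc k))) (pascal n k))
    (trans (lemma (+ (n C k)) (+ (n C suc k)) (u k) (v k)) (cong (_+_ (V n (suc k))) (sym (X-⊛-suc (V n ⊕ ⊝ U n) k))))
    where
    lemma : ∀ a b c d → - ((a + b) * (c + d)) ≡ - (b * (c + d)) + (- (a * d) + - (a * c))
    lemma = solve-∀

  -- `quad` is the norm (1 + (1 - i) x) (1 + (1 + i) x), and norms are multiplicative.
  quad^ : ∀ n → quad ^ n ≗ U n ⊛ U n ⊕ V n ⊛ V n
  quad^ zero    k = begin
    const 1ℤ k                                      ≡⟨ units k ⟩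
    (const 1ℤ ⊛ const 1ℤ ⊕ const 0ℤ ⊛ const 0ℤ) k   ≡⟨ cong₂ _+_ (⊛-cong U₀ U₀ k) (⊛-cong V₀ V₀ k) ⟨
    (U 0 ⊛ U 0 ⊕ V 0 ⊛ V 0) k ∎
    where
    open ≡-Reasoning
    units : const 1ℤ ≗ const 1ℤ ⊛ const 1ℤ ⊕ const 0ℤ ⊛ const 0ℤ
    units = solve 0 (con 1ℤ := con 1ℤ :* con 1ℤ :+ con 0ℤ :* con 0ℤ) (λ _ → refl)
    U₀ : U 0 ≗ const 1ℤ
    U₀ zero    = refl
    U₀ (suc k) = refl
    V₀ : V 0 ≗ const 0ℤ
    V₀ zero    = refl
    V₀ (suc k) = refl
  quad^ (suc n) k = begin
    (quad ⊛ quad ^ n) k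
      ≡⟨ ⊛-cong {quad} (λ _ → refl) (quad^ n) k ⟩
    (quad ⊛ (U n ⊛ U n ⊕ V n ⊛ V n)) k
      ≡⟨ norm X (U n) (V n) k ⟩
    ((U n ⊕ X ⊛ (U n ⊕ V n)) ⊛ (U n ⊕ X ⊛ (U n ⊕ V n)) ⊕
     (V n ⊕ X ⊛ (V n ⊕ ⊝ U n)) ⊛ (V n ⊕ X ⊛ (V n ⊕ ⊝ U n))) k
      ≡⟨ cong₂ _+_ (⊛-cong (U-suc n) (U-suc n) k) (⊛-cong (V-suc n) (V-suc n) k) ⟨
    (U (suc n) ⊛ U (suc n) ⊕ V (suc n) ⊛ V (suc n)) k ∎
    where
    open ≡-Reasoning
    norm : ∀ x u v → (const 1ℤ ⊕ const (+ 2) ⊛ x ⊕ const (+ 2) ⊛ x ^ 2) ⊛ (u ⊛ u ⊕ v ⊛ v) ≗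
      (u ⊕ x ⊛ (u ⊕ v)) ⊛ (u ⊕ x ⊛ (u ⊕ v)) ⊕ (v ⊕ x ⊛ (v ⊕ ⊝ u)) ⊛ (v ⊕ x ⊛ (v ⊕ ⊝ u))
    norm = solve 3 (λ x u v →
      (con 1ℤ :+ con (+ 2) :* x :+ con (+ 2) :* x :^ 2) :* (u :* u :+ v :* v) :=
      (u :+ x :* (u :+ v)) :* (u :+ x :* (u :+ v)) :+ (v :+ x :* (v :+ :- u)) :* (v :+ x :* (v :+ :- u)))
      (λ _ → refl)

  linear^-zero : ∀ b n → (linear 1ℤ b ^ n) 0 ≡ 1ℤ
  linear^-zero b n = trans (^-zero (linear 1ℤ b) n)
    (trans (cong (ℤ._^ n) (unit b)) (ℤ.^-zeroˡ n))
    where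
    unit : ∀ b → 1ℤ + b * 0ℤ ≡ 1ℤ
    unit = solve-∀

  ⊛-∑ : ∀ f g n → (f ⊛ g) n ≡ ∑[ i < suc n ] (f (toℕ i) * g (n ℕ.∸ toℕ i))
  ⊛-∑ f g zero    = sym (ℤ.+-identityʳ _)
  ⊛-∑ f g (suc n) = cong (_+_ (f 0 * g (suc n))) (⊛-∑ (f ∘ suc) g n)

  ∑-*ʳ : ∀ n (f : Fin n → ℤ) c → ∑[ i < n ] (f i * c) ≡ ∑[ i < n ] f i * c
  ∑-*ʳ zero    f c = sym (ℤ.*-zeroˡ c)
  ∑-*ʳ (suc n) f c = trans (cong (_+_ (f zero * c)) (∑-*ʳ n (f ∘ suc) c)) (sym (ℤ.*-distribʳ-+ c (f zero) _))

  -- Congruences for a fixed odd prime p = 2j + 3.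

  module OddPrime (j : ℕ) (p-prime : Prime (suc (suc j ℕ.* 2))) where

    -- The form p = 2 + m suits the removal of two end terms; `suc m` = p - 1 is the number of
    -- summands.
    m p : ℕ
    m = suc (j ℕ.* 2)
    p = 2 ℕ.+ m

    -- Congruences modulo p².

    module _ where

      p² : ℤ
      p² = + p * + p

      open import Relation.Binary.Reasoning.Setoid (≋-setoid {p²})

      middle : ∀ f k → k ℕ.≤ m → + p ∣ (f ^ p) (suc k)
      middle f k k≤m = prime∣^ p-prime f k (ℕ.s≤s (ℕ.s≤s k≤m))

      ends : ∀ f g → (f ^ p ⊛ g ^ p) p ≋ (f ^ p) 0 * (g ^ p) p + (f ^ p) p * (g ^ p) 0 [ p² ]
      ends f g = ⊛-ends-≋ (f ^ p) (g ^ p) m (middle f) (middle g)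

      p∣pCk : ∀ k → k ℕ.≤ m → + p ∣ + (p C suc k)
      p∣pCk k k≤m = subst (+ p ∣_) (binomial-coefficient p (suc k)) (middle (linear 1ℤ 1ℤ) k k≤m)

      -- Only the end terms of U² + V² count: `U p` has constant term 1 and top coefficient `u p`,
      -- while the constant term of `V p` is 0.
      quad^-top : (quad ^ p) p ≋ + 2 * u p [ p² ]
      quad^-top = begin
        (quad ^ p) p                             ≡⟨ quad^ p p ⟩
        (U p ⊛ U p) p + (V p ⊛ V p) p
          ≈⟨ ≋-+ (⊛-ends-≋ (U p) (U p) m p∣U p∣U) (⊛-ends-≋ (V p) (V p) m p∣V p∣V) ⟩
        U p 0 * U p p + U p p * U p 0 + (V p 0 * V p p + V p p * V p 0)
          ≡⟨ cong (λ r → U p 0 * (+ r * u p) + + r * u p * U p 0 + (V p 0 * V p p + V p p * V p 0)) (nCn≡1 p) ⟩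
        U p 0 * (1ℤ * u p) + 1ℤ * u p * U p 0 + (V p 0 * V p p + V p p * V p 0)
          ≡⟨ lemma (u p) (V p p) ⟩
        + 2 * u p ∎
        where
        p∣U : ∀ k → k ℕ.≤ m → + p ∣ U p (suc k)
        p∣U k k≤m = ∣m⇒∣m*n (u (suc k)) (p∣pCk k k≤m)
        p∣V : ∀ k → k ℕ.≤ m → + p ∣ V p (suc k)
        p∣V k k≤m = ∣m⇒∣-m (∣m⇒∣m*n (v (suc k)) (p∣pCk k k≤m))
        lemma : ∀ a b → 1ℤ * 1ℤ * (1ℤ * a) + 1ℤ * a * (1ℤ * 1ℤ) + (- (1ℤ * 0ℤ) * b + b * - (1ℤ * 0ℤ)) ≡ + 2 * a
        lemma = solve-∀

      L : Series
      L = linear 1ℤ 1ℤ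

      -- This coefficient is C(2p,p), and the one in `[L³]^p-top` is C(3p,p). Splitting off one
      -- factor (1 + x)ᵖ at a time reduces each to end terms.
      [L²]^p-top : ((L ⊛ L) ^ p) p ≋ + 2 [ p² ]
      [L²]^p-top = begin
        ((L ⊛ L) ^ p) p                               ≡⟨ ^-distrib-* L L p p ⟩
        (L ^ p ⊛ L ^ p) p                             ≈⟨ ends L L ⟩
        (L ^ p) 0 * (L ^ p) p + (L ^ p) p * (L ^ p) 0
          ≡⟨ cong₂ (λ r s → r * s + s * r) (linear^-zero 1ℤ p) (trans (linear^-top 1ℤ 1ℤ p) (ℤ.^-zeroˡ p)) ⟩
        + 2 ∎

      [L³]^p-top : ((L ⊛ (L ⊛ L)) ^ p) p ≋ + 3 [ p² ]
      [L³]^p-top = begin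
        ((L ⊛ (L ⊛ L)) ^ p) p                         ≡⟨ ^-distrib-* L (L ⊛ L) p p ⟩
        (L ^ p ⊛ (L ⊛ L) ^ p) p                       ≈⟨ ends L (L ⊛ L) ⟩
        (L ^ p) 0 * ((L ⊛ L) ^ p) p + (L ^ p) p * ((L ⊛ L) ^ p) 0
          ≡⟨ cong₂ (λ r s → r * ((L ⊛ L) ^ p) p + s) (linear^-zero 1ℤ p)
               (cong₂ _*_ (trans (linear^-top 1ℤ 1ℤ p) (ℤ.^-zeroˡ p)) (trans (^-zero (L ⊛ L) p) (ℤ.^-zeroˡ p))) ⟩
        1ℤ * ((L ⊛ L) ^ p) p + 1ℤ                     ≈⟨ ≋-+ (≋-*ˡ 1ℤ [L²]^p-top) (≋-reflexive refl) ⟩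
        + 3 ∎

      B-top : B p ≋ (+ 2) ℤ.^ p * + 3 [ p² ]
      B-top = begin
        (cubic ^ p) p                                 ≡⟨ ^-congˡ p cubic-L p ⟩
        ((const (+ 2) ⊛ (L ⊛ (L ⊛ L))) ^ p) p         ≡⟨ const-⊛-^ (+ 2) (L ⊛ (L ⊛ L)) p p ⟩
        (+ 2) ℤ.^ p * ((L ⊛ (L ⊛ L)) ^ p) p           ≈⟨ ≋-*ˡ ((+ 2) ℤ.^ p) [L³]^p-top ⟩
        (+ 2) ℤ.^ p * + 3 ∎
        where
        cubic-L : cubic ≗ const (+ 2) ⊛ (L ⊛ (L ⊛ L))
        cubic-L = solve 1 (λ l → con (+ 2) :* l :^ 3 := con (+ 2) :* (l :* (l :* l))) (λ _ → refl) L

      cubic-X^p-top : ((cubic ⊕ ⊝ X) ^ p) p ≋ (+ 2) ℤ.^ p * (+ 2 * u p) + 1ℤ [ p² ]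
      cubic-X^p-top = begin
        ((cubic ⊕ ⊝ X) ^ p) p                         ≡⟨ ^-congˡ p cubic-X p ⟩
        ((linear (+ 2) 1ℤ ⊛ quad) ^ p) p              ≡⟨ ^-distrib-* (linear (+ 2) 1ℤ) quad p p ⟩
        (linear (+ 2) 1ℤ ^ p ⊛ quad ^ p) p            ≈⟨ ends (linear (+ 2) 1ℤ) quad ⟩
        (linear (+ 2) 1ℤ ^ p) 0 * (quad ^ p) p + (linear (+ 2) 1ℤ ^ p) p * (quad ^ p) 0
          ≡⟨ cong₂ (λ r s → r * (quad ^ p) p + s) (^-zero (linear (+ 2) 1ℤ) p)
               (cong₂ _*_ (trans (linear^-top (+ 2) 1ℤ p) (ℤ.^-zeroˡ p)) (trans (^-zero quad p) (ℤ.^-zeroˡ p))) ⟩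
        (+ 2) ℤ.^ p * (quad ^ p) p + 1ℤ
          ≈⟨ ≋-+ (≋-*ˡ ((+ 2) ℤ.^ p) quad^-top) (≋-reflexive refl) ⟩
        (+ 2) ℤ.^ p * (+ 2 * u p) + 1ℤ ∎

      F : Series
      F = linear 1ℤ -1ℤ ^ p

      F-top : F p ≡ -1ℤ
      F-top = trans (linear^-top 1ℤ -1ℤ p) (-1^ (suc j))

      -- The part of [xᵖ] (1-x)ᵖ Σ B k xᵏ = [xᵖ] (2(1+x)³ - x)ᵖ coming from 0 < k < p.
      mid : ℤ
      mid = ((B ∘ suc) ⊛ (F ∘ suc)) m

      -- The end terms of (1-x)ᵖ Σ B k xᵏ are B p and, p being odd, -B 0 = -1.
      cubic-X^p-expansion : ((cubic ⊕ ⊝ X) ^ p) p ≡ mid + B p - 1ℤ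
      cubic-X^p-expansion = trans (cubic-X^ p) (trans (⊛-comm F B p) (trans (⊛-ends B F m)
        (trans (cong₂ (λ r s → 1ℤ * r + (B p * s + mid)) F-top (linear^-zero -1ℤ p)) (lemma (B p) mid))))
        where
        lemma : ∀ a b → 1ℤ * -1ℤ + (a * 1ℤ + b) ≡ b + a - 1ℤ
        lemma = solve-∀

      p²∣mid : p² ∣ mid
      p²∣mid = ≋0⇒∣ (begin
        mid                                                      ≡⟨ lemma₁ mid (B p) ⟩
        mid + B p - 1ℤ + -1ℤ * B p + 1ℤ
          ≡⟨ cong (λ r → r + -1ℤ * B p + 1ℤ) cubic-X^p-expansion ⟨
        ((cubic ⊕ ⊝ X) ^ p) p + -1ℤ * B p + 1ℤ
          ≈⟨ ≋-+ (≋-+ cubic-X^p-top (≋-*ˡ -1ℤ B-top)) (≋-reflexive refl) ⟩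
        t * (+ 2 * u p) + 1ℤ + -1ℤ * (t * + 3) + 1ℤ
          ≡⟨ cong (λ t → t * (+ 2 * u p) + 1ℤ + -1ℤ * (t * + 3) + 1ℤ) (2u²≡2^ (suc j)) ⟨
        -- With 2ᵖ rewritten as 2t², t = `u p`, this is the polynomial 4t³ - 6t² + 2. Its double
        -- root at 1 turns t ≡ 1 modulo p into divisibility by p².
        s * (+ 2 * u p) + 1ℤ + -1ℤ * (s * + 3) + 1ℤ              ≡⟨ lemma₂ (u p) ⟩
        (u p - 1ℤ) * (u p - 1ℤ) * (+ 2 * (+ 2 * u p + 1ℤ))
          ≈⟨ ∣⇒≋0 (∣m⇒∣m*n (+ 2 * (+ 2 * u p + 1ℤ)) (*-mono-∣ p∣u-1 p∣u-1)) ⟩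
        0ℤ ∎)
        where
        t s : ℤ
        t = (+ 2) ℤ.^ p
        s = + 2 * (u p * u p)
        p∣u-1 : + p ∣ u p - 1ℤ
        p∣u-1 = _≋_[_].n∣a-b (u-prime (suc j) p-prime)
        lemma₁ : ∀ a b → a ≡ a + b - 1ℤ + -1ℤ * b + 1ℤ
        lemma₁ = solve-∀
        lemma₂ : ∀ a → + 2 * (a * a) * (+ 2 * a) + 1ℤ + -1ℤ * (+ 2 * (a * a) * + 3) + 1ℤ ≡
          (a - 1ℤ) * (a - 1ℤ) * (+ 2 * (+ 2 * a + 1ℤ))
        lemma₂ = solve-∀

    -- The first sum modulo p.

    open import Relation.Binary.Reasoning.Setoid (≋-setoid {+ p})

    χ : ℤ
    χ = -1ℤ ℤ.^ suc j

    p∤2 : ¬ (p ℕ.∣ 2)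
    p∤2 = ℕ.>⇒∤ (ℕ.s≤s (ℕ.s≤s (ℕ.s≤s ℕ.z≤n)))

    cancel-2 : ∀ {a b} → + 2 * a ≋ + 2 * b [ + p ] → a ≋ b [ + p ]
    cancel-2 {a} {b} (mod 2a≋2b) = mod (prime-cancel p-prime p∤2 (subst (+ p ∣_) (lemma a b) 2a≋2b))
      where
      lemma : ∀ a b → + 2 * a - + 2 * b ≡ + 2 * (a - b)
      lemma = solve-∀

    u≋1 : u p ≋ 1ℤ [ + p ]
    u≋1 = u-prime (suc j) p-prime

    2^p≋2 : (+ 2) ℤ.^ p ≋ + 2 [ + p ]
    2^p≋2 = begin
      (+ 2) ℤ.^ p        ≡⟨ 2u²≡2^ (suc j) ⟨
      + 2 * (u p * u p)  ≈⟨ ≋-*ˡ (+ 2) (≋-* u≋1 u≋1) ⟩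
      + 2 ∎

    E : Series
    E = cubic ^ p ⊕ ⊝ X ^ p

    E-zero : E 0 ≋ + 2 [ + p ]
    E-zero = begin
      (cubic ^ p) 0 - (X ^ p) 0 ≡⟨ cong₂ _-_ (^-zero cubic p) (^-zero X p) ⟩
      (+ 2) ℤ.^ p - 0ℤ          ≡⟨ ℤ.+-identityʳ _ ⟩
      (+ 2) ℤ.^ p               ≈⟨ 2^p≋2 ⟩
      + 2 ∎

    E-suc : ∀ k → suc k ℕ.< p → E (suc k) ≋ 0ℤ [ + p ]
    E-suc k k<p = ∣⇒≋0 (∣m∣n⇒∣m-n (prime∣^ p-prime cubic k k<p) (prime∣^ p-prime X k k<p))

    -- As (2 + x) `quad` G = `E` for the geometric series G, these are E / (2 + x) and E / `quad`.
    y z : Series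
    y = quad ⊛ geometric p
    z = linear (+ 2) 1ℤ ⊛ geometric p

    linear-⊛-y : linear (+ 2) 1ℤ ⊛ y ≗ E
    linear-⊛-y k = trans (sym (⊛-assoc (linear (+ 2) 1ℤ) quad (geometric p) k))
      (trans (sym (⊛-cong {g = geometric p} cubic-X (λ _ → refl) k)) (cubic-X-⊛-geometric p k))

    quad-⊛-z : quad ⊛ z ≗ E
    quad-⊛-z k = trans (sym (⊛-assoc quad (linear (+ 2) 1ℤ) (geometric p) k))
      (trans (⊛-cong {g = geometric p} (⊛-comm quad (linear (+ 2) 1ℤ)) (λ _ → refl) k)
      (trans (sym (⊛-cong {g = geometric p} cubic-X (λ _ → refl) k)) (cubic-X-⊛-geometric p k)))

    -- Below xᵖ, (2 + x) y ≡ 2, so y k is (-1/2)ᵏ modulo p; the factor (-2)ᵏ⁺¹ clears the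
    -- denominator.
    y-solution : ∀ k → k ℕ.< p → (- + 2) ℤ.^ suc k * y k ≋ - + 2 [ + p ]
    y-solution zero k<p = begin
      - + 2 * 1ℤ * y 0   ≡⟨ lemma (y 0) ⟩
      -1ℤ * (+ 2 * y 0)  ≡⟨ cong (_*_ -1ℤ) (linear-⊛-zero (+ 2) 1ℤ y) ⟨
      -1ℤ * (linear (+ 2) 1ℤ ⊛ y) 0  ≡⟨ cong (_*_ -1ℤ) (linear-⊛-y 0) ⟩
      -1ℤ * E 0          ≈⟨ ≋-*ˡ -1ℤ E-zero ⟩
      - + 2 ∎
      where
      lemma : ∀ a → - + 2 * 1ℤ * a ≡ -1ℤ * (+ 2 * a)
      lemma = solve-∀
    y-solution (suc k) k<p = begin
      - + 2 * t * y (suc k)                           ≡⟨ lemma t (y (suc k)) (y k) ⟩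
      t * y k + - t * (+ 2 * y (suc k) + 1ℤ * y k)
        ≡⟨ cong (λ r → t * y k + - t * r) (linear-⊛-suc (+ 2) 1ℤ y k) ⟨
      t * y k + - t * (linear (+ 2) 1ℤ ⊛ y) (suc k)
        ≡⟨ cong (λ r → t * y k + - t * r) (linear-⊛-y (suc k)) ⟩
      t * y k + - t * E (suc k)
        ≈⟨ ≋-+ (y-solution k (ℕ.<-trans (ℕ.n<1+n k) k<p)) (≋-*ˡ (- t) (E-suc k k<p)) ⟩
      - + 2 + - t * 0ℤ                                ≡⟨ cong (_+_ (- + 2)) (ℤ.*-zeroʳ (- t)) ⟩
      - + 2 ∎
      where
      t : ℤ
      t = (- + 2) ℤ.^ suc k
      lemma : ∀ t a b → - + 2 * t * a ≡ t * b + - t * (+ 2 * a + 1ℤ * b)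
      lemma = solve-∀

    -- At k = p - 1 the factor in `y-solution` is (-2)ᵖ = -2ᵖ ≡ -2, which cancels against the
    -- right-hand side.
    y-last : y (suc m) ≋ 1ℤ [ + p ]
    y-last = cancel-2 (begin
      + 2 * y (suc m)                      ≈⟨ ≋-* 2^p≋2 (≋-reflexive {a = y (suc m)} refl) ⟨
      (+ 2) ℤ.^ p * y (suc m)              ≡⟨ lemma ((+ 2) ℤ.^ p) (y (suc m)) ⟩
      -1ℤ * (- (+ 2) ℤ.^ p * y (suc m))    ≡⟨ cong (λ r → -1ℤ * (r * y (suc m))) (-2^ (suc j)) ⟨
      -1ℤ * ((- + 2) ℤ.^ p * y (suc m))    ≈⟨ ≋-*ˡ -1ℤ (y-solution (suc m) ℕ.≤-refl) ⟩
      + 2 * 1ℤ ∎)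
      where
      lemma : ∀ t a → t * a ≡ -1ℤ * (- t * a)
      lemma = solve-∀

    -- Σ c k xᵏ = 1 / (1 + 2x + 2x²)
    c : Series
    c k = -1ℤ ℤ.^ k * v (suc k)

    -- From (1 + i)² = 2 (1 + i) - 2 come the relations v (k+2) = 2 v (k+1) - 2 v k; the signs (-1)ᵏ
    -- turn them into this one.
    c-recurrence : ∀ k → c (2 ℕ.+ k) ≡ - (+ 2 * (c (suc k) + c k))
    c-recurrence k = lemma (-1ℤ ℤ.^ k) (u k) (v k)
      where
      lemma : ∀ s a b → let a₁ = a - b ; b₁ = a + b ; a₂ = a₁ - b₁ ; b₂ = a₁ + b₁ in
        -1ℤ * (-1ℤ * s) * (a₂ + b₂) ≡ - (+ 2 * (-1ℤ * s * b₂ + s * b₁))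
      lemma = solve-∀

    -- Below xᵖ, `quad` z ≡ 2, so z and 2c obey the same recurrence modulo p; it has order two,
    -- hence the pair of consecutive values.
    z-solution : ∀ k → suc k ℕ.< p →
      (z k ≋ + 2 * c k [ + p ]) × (z (suc k) ≋ + 2 * c (suc k) [ + p ])
    z-solution zero k<p = z₀ , (begin
      z 1                            ≡⟨ lemma (z 1) (z 0) ⟩
      z 1 + + 2 * z 0 + - + 2 * z 0  ≡⟨ cong (_+ - + 2 * z 0) (trans (sym (quad-⊛-one z)) (quad-⊛-z 1)) ⟩
      E 1 + - + 2 * z 0              ≈⟨ ≋-+ (E-suc 0 k<p) (≋-*ˡ (- + 2) z₀) ⟩
      + 2 * c 1 ∎)
      where
      lemma : ∀ a b → a ≡ a + + 2 * b + - + 2 * b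
      lemma = solve-∀
      z₀ : z 0 ≋ + 2 * c 0 [ + p ]
      z₀ = begin
        z 0               ≡⟨ ℤ.*-identityˡ (z 0) ⟨
        (quad ⊛ z) 0      ≡⟨ quad-⊛-z 0 ⟩
        E 0               ≈⟨ E-zero ⟩
        + 2 * c 0 ∎
    z-solution (suc k) k<p with z-solution k (ℕ.<-trans (ℕ.n<1+n (suc k)) k<p)
    ... | zₖ , zₖ₊₁ = zₖ₊₁ , (begin
      z (2 ℕ.+ k)                                   ≡⟨ lemma₁ (z (2 ℕ.+ k)) (z (suc k)) (z k) ⟩
      z (2 ℕ.+ k) + + 2 * (z (suc k) + z k) + - + 2 * (z (suc k) + z k)
        ≡⟨ cong (_+ - + 2 * (z (suc k) + z k)) (trans (sym (quad-⊛-suc² z k)) (quad-⊛-z (2 ℕ.+ k))) ⟩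
      E (2 ℕ.+ k) + - + 2 * (z (suc k) + z k)
        ≈⟨ ≋-+ (E-suc (suc k) k<p) (≋-*ˡ (- + 2) (≋-+ zₖ₊₁ zₖ)) ⟩
      0ℤ + - + 2 * (+ 2 * c (suc k) + + 2 * c k)    ≡⟨ lemma₂ (c (suc k)) (c k) ⟩
      + 2 * - (+ 2 * (c (suc k) + c k))             ≡⟨ cong (_*_ (+ 2)) (c-recurrence k) ⟨
      + 2 * c (2 ℕ.+ k) ∎)
      where
      lemma₁ : ∀ a b c → a ≡ a + + 2 * (b + c) + - + 2 * (b + c)
      lemma₁ = solve-∀
      lemma₂ : ∀ b c → 0ℤ + - + 2 * (+ 2 * b + + 2 * c) ≡ + 2 * - (+ 2 * (b + c))
      lemma₂ = solve-∀

    z-last : z m ≋ 1ℤ - χ [ + p ]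
    z-last = begin
      z m                        ≈⟨ proj₁ (z-solution m ℕ.≤-refl) ⟩
      + 2 * (-1ℤ ℤ.^ m * v (suc m))  ≡⟨ cong (λ r → + 2 * (r * v (suc m))) (-1^ j) ⟩
      -- Here suc m = p - 1, and (1 + i)ᵖ = (1 + i) (1 + i)ᵖ⁻¹ gives u p - v p = -2 v (p - 1).
      + 2 * (-1ℤ * v (suc m))    ≡⟨ lemma (u (suc m)) (v (suc m)) ⟩
      u p + -1ℤ * v p            ≈⟨ ≋-+ u≋1 (≋-*ˡ -1ℤ (v-prime (suc j) p-prime)) ⟩
      1ℤ + -1ℤ * χ               ≡⟨ cong (_+_ 1ℤ) (ℤ.-1*i≡-i χ) ⟩
      1ℤ - χ ∎
      where
      lemma : ∀ a b → + 2 * (-1ℤ * b) ≡ a - b + -1ℤ * (a + b)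
      lemma = solve-∀

    -- From 1 - 2x = (1 + 2x + 2x²) - 2x (2 + x).
    partial-fraction : linear 1ℤ (- + 2) ⊛ geometric p ≗ y ⊕ const (- + 2) ⊛ (X ⊛ z)
    partial-fraction = solve 2
      (λ x s → (con 1ℤ :+ con (- + 2) :* x) :* s :=
               (con 1ℤ :+ con (+ 2) :* x :+ con (+ 2) :* x :^ 2) :* s :+
               con (- + 2) :* (x :* ((con (+ 2) :+ con 1ℤ :* x) :* s)))
      (λ _ → refl) X (geometric p)

    ∑A≋ : ∑[ i < suc m ] A (suc (toℕ i)) ≋ + 2 * (χ - 1ℤ) [ + p ]
    ∑A≋ = begin
      -- The geometric series also contains the term k = 0, which is `A 0` = 1.
      ∑[ i < suc m ] A (suc (toℕ i))                 ≡⟨ drop-1 _ ⟩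
      ∑[ i < suc (suc m) ] A (toℕ i) - 1ℤ            ≡⟨ cong (_- 1ℤ) (∑-A (suc m)) ⟨
      (linear 1ℤ (- + 2) ⊛ geometric p) (suc m) - 1ℤ         ≡⟨ cong (_- 1ℤ) (partial-fraction (suc m)) ⟩
      y (suc m) + (const (- + 2) ⊛ (X ⊛ z)) (suc m) - 1ℤ
        ≡⟨ cong (λ r → y (suc m) + r - 1ℤ) (trans (const-⊛ (- + 2) (X ⊛ z) (suc m)) (cong (_*_ (- + 2)) (X-⊛-suc z m))) ⟩
      y (suc m) + - + 2 * z m - 1ℤ
        ≈⟨ ≋-+ (≋-+ y-last (≋-*ˡ (- + 2) z-last)) (≋-reflexive refl) ⟩
      1ℤ + - + 2 * (1ℤ - χ) - 1ℤ                     ≡⟨ lemma χ ⟩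
      + 2 * (χ - 1ℤ) ∎
      where
      drop-1 : ∀ r → r ≡ 1ℤ + r - 1ℤ
      drop-1 = solve-∀
      lemma : ∀ r → 1ℤ + - + 2 * (1ℤ - r) - 1ℤ ≡ + 2 * (r - 1ℤ)
      lemma = solve-∀

    -- The second sum modulo p.

    D : Series
    D = linear 1ℤ -1ℤ ^ suc m

    p∣F : ∀ k → k ℕ.≤ m → + p ∣ F (suc k)
    p∣F = middle (linear 1ℤ -1ℤ)

    -- Since (1 - x) D = F and p divides the middle coefficients of F, neighbouring coefficients of
    -- D agree modulo p, starting from D 0 = 1.
    D≋1 : ∀ k → k ℕ.≤ suc m → D k ≋ 1ℤ [ + p ]
    D≋1 zero    _   = ≋-reflexive (linear^-zero -1ℤ (suc m))
    D≋1 (suc k) (ℕ.s≤s k≤m) = begin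
      D (suc k)                                  ≡⟨ lemma (D (suc k)) (D k) ⟩
      1ℤ * D (suc k) + -1ℤ * D k + D k           ≡⟨ cong (_+ D k) (linear-⊛-suc 1ℤ -1ℤ D k) ⟨
      F (suc k) + D k                            ≈⟨ ≋-+ (∣⇒≋0 (p∣F k k≤m)) (D≋1 k (ℕ.m≤n⇒m≤1+n k≤m)) ⟩
      1ℤ ∎
      where
      lemma : ∀ a b → a ≡ 1ℤ * a + -1ℤ * b + b
      lemma = solve-∀

    m∸i≤m : ∀ (i : Fin (suc m)) → m ℕ.∸ toℕ i ℕ.≤ m
    m∸i≤m i = ℕ.m∸n≤m m (toℕ i)

    -- For k = 1 + i, M i = [xᵖ⁻ᵏ] (1-x)ᵖ / p, which is an inverse of k modulo p.
    M : Fin (suc m) → ℤ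
    M i = _∣_.quotient (p∣F (m ℕ.∸ toℕ i) (m∸i≤m i))

    M-* : ∀ i → F (suc (m ℕ.∸ toℕ i)) ≡ M i * + p
    M-* i = _∣_.equality (p∣F (m ℕ.∸ toℕ i) (m∸i≤m i))

    -- The convolution `mid` pairs B k with F (p - k), which is p times the inverse of k. So `mid`
    -- is p times this sum, and one factor p cancels from p² ∣ `mid`.
    p∣∑BM : + p ∣ ∑[ i < suc m ] (B (suc (toℕ i)) * M i)
    p∣∑BM = *-cancelʳ-∣ (+ p) (subst (p² ∣_) eq p²∣mid)
      where
      eq : mid ≡ ∑[ i < suc m ] (B (suc (toℕ i)) * M i) * + p
      eq = trans (⊛-∑ (B ∘ suc) (F ∘ suc) m)
        (trans (sum-cong-≗ {suc m} (λ i → trans (cong (_*_ (B (suc (toℕ i)))) (M-* i))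
                                           (sym (ℤ.*-assoc (B (suc (toℕ i))) (M i) (+ p)))))
          (∑-*ʳ (suc m) (λ i → B (suc (toℕ i)) * M i) (+ p)))

    -- For l + 1 = p - k, the power rule for (1-x)ᵖ gives (l + 1) `M i` = -D l ≡ -1, and l + 1 ≡ -k
    -- modulo p.
    kM≋1 : ∀ i → + suc (toℕ i) * M i ≋ 1ℤ [ + p ]
    kM≋1 i = begin
      + suc (toℕ i) * M i                        ≡⟨ lemma₁ (+ suc (toℕ i)) (+ suc l) (M i) ⟩
      (+ suc (toℕ i) + + suc l) * M i + -1ℤ * (+ suc l * M i)
        ≡⟨ cong (λ r → + r * M i + -1ℤ * (+ suc l * M i)) i+l≡p ⟩
      + p * M i + -1ℤ * (+ suc l * M i)          ≡⟨ cong (λ r → + p * M i + -1ℤ * r) lM≡-D ⟩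
      + p * M i + -1ℤ * (-1ℤ * D l)
        ≈⟨ ≋-+ (∣⇒≋0 (∣m⇒∣m*n (M i) ∣-refl)) (≋-*ˡ -1ℤ (≋-*ˡ -1ℤ (D≋1 l (ℕ.m≤n⇒m≤1+n (m∸i≤m i))))) ⟩
      1ℤ ∎
      where
      l : ℕ
      l = m ℕ.∸ toℕ i
      lemma₁ : ∀ a b c → a * c ≡ (a + b) * c + -1ℤ * (b * c)
      lemma₁ = solve-∀
      i+l≡p : suc (toℕ i) ℕ.+ suc l ≡ p
      i+l≡p = cong suc (trans (ℕ.+-suc (toℕ i) l) (cong suc (ℕ.m+[n∸m]≡n (toℕ≤pred[n] i))))
      lemma₂ : ∀ a b c → a * (b * c) ≡ c * (a * b)
      lemma₂ = solve-∀
      lM≡-D : + suc l * M i ≡ -1ℤ * D l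
      lM≡-D = ℤ.*-cancelˡ-≡ (+ p) (+ suc l * M i) (-1ℤ * D l)
        (trans (sym (trans (cong (_*_ (+ suc l)) (M-* i)) (lemma₂ (+ suc l) (M i) (+ p))))
        (trans (θ-^-suc (linear 1ℤ -1ℤ) (suc m) (suc l)) (cong (_*_ (+ p)) θ-term)))
        where
        θ-term : (D ⊛ θ (linear 1ℤ -1ℤ)) (suc l) ≡ -1ℤ * D l
        θ-term = trans (⊛-comm D (θ (linear 1ℤ -1ℤ)) (suc l))
          (trans (⊛-cong {g = D} (θ-linear 1ℤ -1ℤ) (λ _ → refl) (suc l))
          (trans (⊛-assoc (const -1ℤ) X D (suc l))
          (trans (const-⊛ -1ℤ (X ⊛ D) (suc l)) (cong (_*_ -1ℤ) (X-⊛-suc D l)))))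

    -- From B k = (2k+1) A k we have A k / k = B k / k - 2 A k.
    A/k : Fin (suc m) → ℤ
    A/k i = B (suc (toℕ i)) * M i + - + 2 * A (suc (toℕ i))

    A/k-* : ∀ i → + suc (toℕ i) * A/k i ≋ A (suc (toℕ i)) [ + p ]
    A/k-* i = begin
      + K * (B K * M i + - + 2 * A K)                    ≡⟨ lemma₁ (+ K) (B K) (M i) (A K) ⟩
      B K * (+ K * M i) + - + 2 * + K * A K
        ≈⟨ ≋-+ (≋-*ˡ (B K) (kM≋1 i)) (≋-reflexive refl) ⟩
      B K * 1ℤ + - + 2 * + K * A K
        ≡⟨ cong (λ r → r * 1ℤ + - + 2 * + K * A K) ([2k+1]A≡B K) ⟨
      + suc (2 ℕ.* K) * A K * 1ℤ + - + 2 * + K * A K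
        ≡⟨ cong (λ r → (1ℤ + r) * A K * 1ℤ + - + 2 * + K * A K) (ℤ.pos-* 2 K) ⟩
      (1ℤ + + 2 * + K) * A K * 1ℤ + - + 2 * + K * A K    ≡⟨ lemma₂ (+ K) (A K) ⟩
      A K ∎
      where
      K : ℕ
      K = suc (toℕ i)
      lemma₁ : ∀ k b m a → k * (b * m + - + 2 * a) ≡ b * (k * m) + - + 2 * k * a
      lemma₁ = solve-∀
      lemma₂ : ∀ k a → (1ℤ + + 2 * k) * a * 1ℤ + - + 2 * k * a ≡ a
      lemma₂ = solve-∀

    ∑A/k : ∑[ i < suc m ] A/k i ≋ + 4 * (1ℤ - χ) [ + p ]
    ∑A/k = begin
      ∑[ i < suc m ] A/k i
        ≡⟨ ∑-distrib-+ {suc m} (λ i → B (suc (toℕ i)) * M i) (λ i → - + 2 * A (suc (toℕ i))) ⟩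
      ∑[ i < suc m ] (B (suc (toℕ i)) * M i) + ∑[ i < suc m ] (- + 2 * A (suc (toℕ i)))
        ≡⟨ cong (_+_ (∑[ i < suc m ] (B (suc (toℕ i)) * M i)))
             (trans (sum-cong-≗ {suc m} (λ i → ℤ.*-comm (- + 2) (A (suc (toℕ i)))))
                    (∑-*ʳ (suc m) (λ i → A (suc (toℕ i))) (- + 2))) ⟩
      ∑[ i < suc m ] (B (suc (toℕ i)) * M i) + ∑[ i < suc m ] A (suc (toℕ i)) * - + 2
        ≈⟨ ≋-+ (∣⇒≋0 p∣∑BM) (≋-* ∑A≋ (≋-reflexive refl)) ⟩
      0ℤ + + 2 * (χ - 1ℤ) * - + 2                         ≡⟨ lemma χ ⟩
      + 4 * (1ℤ - χ) ∎
      where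
      lemma : ∀ r → 0ℤ + + 2 * (r - 1ℤ) * - + 2 ≡ + 4 * (1ℤ - r)
      lemma = solve-∀

-- Transfer to congruences between rational numbers.

module _ where

  open import Data.Integer.Base using (_+_; _*_; -_; _-_)
  open Sum ℤ.+-0-commutativeMonoid using (sum-syntax)
  open Sum ℚ.+-0-commutativeMonoid using () renaming (sum to sumℚ)
  open import Data.Integer.Divisibility.Signed using (divides)

  ↧ₙ-/-∣ : ∀ i n .{{_ : NonZero n}} → ↧ₙ (i ℚ./ n) ℕ.∣ n
  ↧ₙ-/-∣ i n = ℕ.divides ∣ ℤ.gcd i (+ n) ∣
    (trans (cong ∣_∣ (sym (ℚ.↧-/ i n)))
      (trans (ℤ.abs-* (ℚ.↧ (i ℚ./ n)) (ℤ.gcd i (+ n))) (ℕ.*-comm (↧ₙ (i ℚ./ n)) _)))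

  ↧ₙ-/-coprime : ∀ {p} i n .{{_ : NonZero n}} → Coprime n p → Coprime (↧ₙ (i ℚ./ n)) p
  ↧ₙ-/-coprime i n n⊥p (d∣ , d∣p) = n⊥p (ℕ.∣-trans d∣ (↧ₙ-/-∣ i n) , d∣p)

  *-coprime : ∀ {p m n} → Prime p → Coprime m p → Coprime n p → Coprime (m ℕ.* n) p
  *-coprime {m = m} {n} p-prime m⊥p n⊥p {d} (d∣mn , d∣p) with prime⇒irreducible p-prime d∣p
  ... | inj₁ d≡1  = d≡1
  ... | inj₂ refl with euclidsLemma m n p-prime d∣mn
  ...   | inj₁ p∣m = m⊥p (p∣m , ℕ.∣-refl)
  ...   | inj₂ p∣n = n⊥p (p∣n , ℕ.∣-refl)

  -- The sum is the reduced form of a fraction over the product of the two denominators.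
  ↧ₙ-+-coprime : ∀ {p} r s → Prime p → Coprime (↧ₙ r) p → Coprime (↧ₙ s) p →
    Coprime (↧ₙ (r ℚ.+ s)) p
  ↧ₙ-+-coprime r@record{} s@record{} p-prime r⊥p s⊥p =
    ↧ₙ-/-coprime (ℚ.↥ r * ℚ.↧ s + ℚ.↥ s * ℚ.↧ r) (↧ₙ r ℕ.* ↧ₙ s) (*-coprime p-prime r⊥p s⊥p)

  toℚᵘ-/ : ∀ i d → toℚᵘ (i ℚ./ suc d) ≃ mkℚᵘ i d
  toℚᵘ-/ i d = ℚ.toℚᵘ-fromℚᵘ (mkℚᵘ i d)

  fromℤ-+ : ∀ i j → fromℤ (i + j) ≡ fromℤ i ℚ.+ fromℤ j
  fromℤ-+ i j = ℚ.toℚᵘ-injective (begin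
    toℚᵘ (fromℤ (i + j))                 ≈⟨ toℚᵘ-/ (i + j) 0 ⟩
    mkℚᵘ (i + j) 0                       ≈⟨ *≡* (lemma i j) ⟩
    mkℚᵘ i 0 ℚᵘ.+ mkℚᵘ j 0               ≈⟨ ℚᵘ.+-cong (toℚᵘ-/ i 0) (toℚᵘ-/ j 0) ⟨
    toℚᵘ (fromℤ i) ℚᵘ.+ toℚᵘ (fromℤ j)   ≈⟨ ℚ.toℚᵘ-homo-+ (fromℤ i) (fromℤ j) ⟨
    toℚᵘ (fromℤ i ℚ.+ fromℤ j) ∎)
    where
    open import Relation.Binary.Reasoning.Setoid ℚᵘ.≃-setoid
    lemma : ∀ i j → (i + j) * 1ℤ ≡ (i * 1ℤ + j * 1ℤ) * 1ℤ
    lemma = solve-∀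

  fromℤ-*-/ : ∀ i j d → fromℤ i ℚ.* (j ℚ./ suc d) ≡ (i * j) ℚ./ suc d
  fromℤ-*-/ i j d = ℚ.toℚᵘ-injective (begin
    toℚᵘ (fromℤ i ℚ.* (j ℚ./ suc d))            ≈⟨ ℚ.toℚᵘ-homo-* (fromℤ i) (j ℚ./ suc d) ⟩
    toℚᵘ (fromℤ i) ℚᵘ.* toℚᵘ (j ℚ./ suc d)      ≈⟨ ℚᵘ.*-cong (toℚᵘ-/ i 0) (toℚᵘ-/ j d) ⟩
    mkℚᵘ i 0 ℚᵘ.* mkℚᵘ j d
      ≈⟨ *≡* (cong (λ e → i * j * + suc e) (sym (ℕ.+-identityʳ d))) ⟩
    mkℚᵘ (i * j) d                              ≈⟨ toℚᵘ-/ (i * j) d ⟨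
    toℚᵘ ((i * j) ℚ./ suc d) ∎)
    where open import Relation.Binary.Reasoning.Setoid ℚᵘ.≃-setoid

  fromℤ-/ : ∀ i d → (+ suc d * i) ℚ./ suc d ≡ fromℤ i
  fromℤ-/ i d = ℚ.toℚᵘ-injective (begin
    toℚᵘ ((+ suc d * i) ℚ./ suc d)   ≈⟨ toℚᵘ-/ (+ suc d * i) d ⟩
    mkℚᵘ (+ suc d * i) d             ≈⟨ *≡* (lemma (+ suc d) i) ⟩
    mkℚᵘ i 0                         ≈⟨ toℚᵘ-/ i 0 ⟨
    toℚᵘ (fromℤ i) ∎)
    where
    open import Relation.Binary.Reasoning.Setoid ℚᵘ.≃-setoid
    lemma : ∀ e i → e * i * 1ℤ ≡ i * e
    lemma = solve-∀

  /-+ : ∀ i j d → (i + j) ℚ./ suc d ≡ i ℚ./ suc d ℚ.+ j ℚ./ suc d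
  /-+ i j d = ℚ.toℚᵘ-injective (begin
    toℚᵘ ((i + j) ℚ./ suc d)                     ≈⟨ toℚᵘ-/ (i + j) d ⟩
    mkℚᵘ (i + j) d                               ≈⟨ *≡* (lemma i j (+ suc d)) ⟩
    mkℚᵘ i d ℚᵘ.+ mkℚᵘ j d                       ≈⟨ ℚᵘ.+-cong (toℚᵘ-/ i d) (toℚᵘ-/ j d) ⟨
    toℚᵘ (i ℚ./ suc d) ℚᵘ.+ toℚᵘ (j ℚ./ suc d)   ≈⟨ ℚ.toℚᵘ-homo-+ (i ℚ./ suc d) (j ℚ./ suc d) ⟨
    toℚᵘ (i ℚ./ suc d ℚ.+ j ℚ./ suc d) ∎)
    where
    open import Relation.Binary.Reasoning.Setoid ℚᵘ.≃-setoid
    lemma : ∀ i j e → (i + j) * (e * e) ≡ (i * e + j * e) * e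
    lemma = solve-∀

  module _ {p : ℕ} (p-prime : Prime p) where

    ≡mod-+ : ∀ {a b c d} → a ≡ b [mod p ] → c ≡ d [mod p ] → a ℚ.+ c ≡ b ℚ.+ d [mod p ]
    ≡mod-+ {a} {b} {c} {d} (r , r⊥p , a-b≡pr) (s , s⊥p , c-d≡ps) =
      r ℚ.+ s , ↧ₙ-+-coprime r s p-prime r⊥p s⊥p ,
      trans (lemma a b c d) (trans (cong₂ ℚ._+_ a-b≡pr c-d≡ps) (sym (ℚ.*-distribˡ-+ (fromℤ (+ p)) r s)))
      where
      open +-*-Solver
      lemma : ∀ a b c d → a ℚ.+ c ℚ.- (b ℚ.+ d) ≡ (a ℚ.- b) ℚ.+ (c ℚ.- d)
      lemma = solve 4 (λ a b c d → a :+ c :- (b :+ d) := (a :- b) :+ (c :- d)) refl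

    ≡mod-trans : ∀ {a b c} → a ≡ b [mod p ] → b ≡ c [mod p ] → a ≡ c [mod p ]
    ≡mod-trans {a} {b} {c} (r , r⊥p , a-b≡pr) (s , s⊥p , b-c≡ps) =
      r ℚ.+ s , ↧ₙ-+-coprime r s p-prime r⊥p s⊥p ,
      trans (lemma a b c) (trans (cong₂ ℚ._+_ a-b≡pr b-c≡ps) (sym (ℚ.*-distribˡ-+ (fromℤ (+ p)) r s)))
      where
      open +-*-Solver
      lemma : ∀ a b c → a ℚ.- c ≡ (a ℚ.- b) ℚ.+ (b ℚ.- c)
      lemma = solve 3 (λ a b c → a :- c := (a :- b) :+ (b :- c)) refl

    -- The bridge from integers to rationals: a fraction may be replaced by any integer that solves
    -- its defining equation modulo p.
    /-≡mod : ∀ {i z} d → Coprime (suc d) p → + suc d * z ≋ i [ + p ] → i ℚ./ suc d ≡ fromℤ z [mod p ]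
    /-≡mod {i} {z} d d⊥p (mod (divides e eq)) =
      -- Dividing (d + 1) z - i = e p by -(d + 1) gives i/(d + 1) - z = p (-e/(d + 1)).
      (- e) ℚ./ suc d , ↧ₙ-/-coprime (- e) (suc d) d⊥p , (begin
        i ℚ./ suc d ℚ.- fromℤ z
          ≡⟨ cong (λ i → i ℚ./ suc d ℚ.- fromℤ z) (i-eq i (+ suc d * z) (e * + p) eq) ⟩
        (+ suc d * z + - (e * + p)) ℚ./ suc d ℚ.- fromℤ z
          ≡⟨ cong (ℚ._- fromℤ z) (trans (/-+ (+ suc d * z) (- (e * + p)) d) (cong₂ ℚ._+_ (fromℤ-/ z d) refl)) ⟩
        fromℤ z ℚ.+ (- (e * + p)) ℚ./ suc d ℚ.- fromℤ z
          ≡⟨ cancel (fromℤ z) _ ⟩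
        (- (e * + p)) ℚ./ suc d
          ≡⟨ cong (ℚ._/ suc d) (flip e (+ p)) ⟩
        (+ p * - e) ℚ./ suc d
          ≡⟨ fromℤ-*-/ (+ p) (- e) d ⟨
        fromℤ (+ p) ℚ.* ((- e) ℚ./ suc d) ∎)
      where
      open ≡-Reasoning
      i-eq : ∀ i k r → k - i ≡ r → i ≡ k + - r
      i-eq i k _ refl = solved i k
        where
        solved : ∀ i k → i ≡ k + - (k - i)
        solved = solve-∀
      flip : ∀ e p → - (e * p) ≡ p * - e
      flip = solve-∀
      open +-*-Solver
      cancel : ∀ a b → a ℚ.+ b ℚ.- a ≡ b
      cancel = solve 2 (λ a b → a :+ b :- a := b) refl

    fromℤ-≡mod : ∀ {i z} → i ≋ z [ + p ] → fromℤ i ≡ fromℤ z [mod p ]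
    fromℤ-≡mod {i} {z} i≋z = /-≡mod 0 (Coprimality.1-coprimeTo p)
      (≋-trans (≋-reflexive (ℤ.*-identityˡ z)) (≋-sym i≋z))

    ∑-≡mod : ∀ n {f : Fin n → ℚ} {z : Fin n → ℤ} → (∀ i → f i ≡ fromℤ (z i) [mod p ]) →
      sumℚ f ≡ fromℤ (∑[ i < n ] z i) [mod p ]
    ∑-≡mod zero    _     = fromℤ-≡mod {0ℤ} {0ℤ} (≋-reflexive refl)
    ∑-≡mod (suc n) {f} {z} f≡z =
      subst (sumℚ f ≡_[mod p ]) (sym (fromℤ-+ (z zero) (∑[ i < n ] z (suc i))))
        (≡mod-+ {f zero} {fromℤ (z zero)} {sumℚ (f ∘ suc)} {fromℤ (∑[ i < n ] z (suc i))}
          (f≡z zero) (∑-≡mod n (f≡z ∘ suc)))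

    ∑-≋⇒≡mod : ∀ {n} (f : Fin n → ℚ) (z : Fin n → ℤ) {w} →
      (∀ i → f i ≡ fromℤ (z i) [mod p ]) → ∑[ i < n ] z i ≋ w [ + p ] →
      sumℚ f ≡ fromℤ w [mod p ]
    ∑-≋⇒≡mod {n} f z {w} f≡z ∑z≋w =
      ≡mod-trans {sumℚ f} {fromℤ (∑[ i < n ] z i)} {fromℤ w}
        (∑-≡mod n f≡z) (fromℤ-≡mod ∑z≋w)

  pos-^ : ∀ m n → + (m ℕ.^ n) ≡ (+ m) ℤ.^ n
  pos-^ m zero    = refl
  pos-^ m (suc n) = trans (ℤ.pos-* m (m ℕ.^ n)) (cong (_*_ (+ m)) (pos-^ m n))

  2^k*catalan₂ : ∀ k → fromℤ (+ (2 ℕ.^ k)) ℚ.* catalan₂ k ≡ fromℤ (A k)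
  2^k*catalan₂ k = begin
    fromℤ (+ (2 ℕ.^ k)) ℚ.* catalan₂ k
      ≡⟨ fromℤ-*-/ (+ (2 ℕ.^ k)) (+ ((3 ℕ.* k) C k)) (2 ℕ.* k) ⟩
    (+ (2 ℕ.^ k) * + ((3 ℕ.* k) C k)) ℚ./ suc (2 ℕ.* k)
      ≡⟨ cong (ℚ._/ suc (2 ℕ.* k)) (trans (cong (_* + ((3 ℕ.* k) C k)) (pos-^ 2 k)) (sym (cubic^-coefficient k k))) ⟩
    B k ℚ./ suc (2 ℕ.* k)
      ≡⟨ cong (ℚ._/ suc (2 ℕ.* k)) ([2k+1]A≡B k) ⟨
    (+ suc (2 ℕ.* k) * A k) ℚ./ suc (2 ℕ.* k)
      ≡⟨ fromℤ-/ (A k) (2 ℕ.* k) ⟩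
    fromℤ (A k) ∎
    where open ≡-Reasoning

  -- The quotient of p by 2 is (p - 1)/2; it has the form `suc j` because 1 is not prime.
  odd-prime : ∀ {p} → Prime p → ¬ (2 ℕ.∣ p) → ∃[ j ] p ≡ suc (suc j ℕ.* 2)
  odd-prime {p} p-prime 2∤p with p ℕ.% 2 in %-eq | p ℕ./ 2 | ℕ.m≡m%n+[m/n]*n p 2 | ℕ.m%n<n p 2
  ... | 0    | _     | _    | _ = contradiction (ℕ.m%n≡0⇒n∣m p 2 %-eq) 2∤p
  ... | 1    | zero  | refl | _ = contradiction p-prime ¬prime[1]
  ... | 1    | suc j | eq   | _ = j , eq
  ... | 2+ _ | _     | _    | ℕ.s≤s (ℕ.s≤s ())

  -- The exponent h stands for (p - 1)/2; the equation h ≡ `suc j` keeps the evaluation of that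
  -- quotient apart from the congruences.
  congruences : ∀ j {h} → Prime (suc (suc j ℕ.* 2)) → h ≡ suc j → let p = suc (suc j ℕ.* 2) in
    (∑[1≤ k ≤ p ∸ 1 ] (fromℤ (+ (2 ℕ.^ k)) ℚ.* catalan₂ k)
      ≡ fromℤ (+ 2 * (-1ℤ ℤ.^ h - 1ℤ)) [mod p ])
    × (∑[1≤ k ≤ p ∸ 1 ] (fromℤ (+ (2 ℕ.^ k)) ℚ.* catalan₂ k ℚ.* (+ 1 ℚ./ k))
      ≡ fromℤ (+ 4 * (1ℤ - -1ℤ ℤ.^ h)) [mod p ])
  congruences j p-prime refl =
      ∑-≋⇒≡mod p-prime f₁ (λ i → A (suc (toℕ i)))
        (λ i → subst (_≡ fromℤ (A (suc (toℕ i))) [mod p ]) (sym (2^k*catalan₂ (suc (toℕ i))))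
          (fromℤ-≡mod p-prime {A (suc (toℕ i))} (≋-reflexive refl)))
        ∑A≋
    , ∑-≋⇒≡mod p-prime f₂ A/k
        (λ i → subst (_≡ fromℤ (A/k i) [mod p ]) (sym (f₂-/ i))
          (/-≡mod p-prime (toℕ i) (k⊥p i) (A/k-* i)))
        ∑A/k
    where
    open OddPrime j p-prime using (p; ∑A≋; A/k; A/k-*; ∑A/k)
    f₁ f₂ : Fin (suc j ℕ.* 2) → ℚ
    f₁ i = let k = suc (toℕ i) in fromℤ (+ (2 ℕ.^ k)) ℚ.* catalan₂ k
    f₂ i = let k = suc (toℕ i) in fromℤ (+ (2 ℕ.^ k)) ℚ.* catalan₂ k ℚ.* (+ 1 ℚ./ k)
    f₂-/ : ∀ i → f₂ i ≡ A (suc (toℕ i)) ℚ./ suc (toℕ i)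
    f₂-/ i = trans (cong (ℚ._* (+ 1 ℚ./ suc (toℕ i))) (2^k*catalan₂ (suc (toℕ i))))
      (trans (fromℤ-*-/ (A (suc (toℕ i))) (+ 1) (toℕ i))
             (cong (ℚ._/ suc (toℕ i)) (ℤ.*-identityʳ (A (suc (toℕ i))))))
    k⊥p : ∀ (i : Fin (suc j ℕ.* 2)) → Coprime (suc (toℕ i)) p
    k⊥p i = Coprimality.sym (Coprimality.prime⇒coprime p-prime (ℕ.s≤s (toℕ<n i)))

open import Data.Nat.Divisibility.Core using (_∣_)
open import Data.Rational.Base using (_*_; _/_)

theorem1p1 : (p : ℕ) → Prime p → ¬ (2 ∣ p) →
    (∑[1≤ k ≤ p ∸ 1 ] (fromℤ (+ (2 ℕ.^ k)) * catalan₂ k)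
    ≡ fromℤ (+ 2 ℤ.* (-1ℤ ℤ.^ ((p ∸ 1) ℕ./ 2) ℤ.- 1ℤ)) [mod p ])
    × (∑[1≤ k ≤ p ∸ 1 ] (fromℤ (+ (2 ℕ.^ k)) * catalan₂ k * (+ 1 / k))
    ≡ fromℤ (+ 4 ℤ.* (1ℤ ℤ.- -1ℤ ℤ.^ ((p ∸ 1) ℕ./ 2))) [mod p ])
theorem1p1 p p-prime 2∤p with odd-prime p-prime 2∤p
... | j , refl = congruences j p-prime (ℕ.m*n/n≡m (suc j) 2)
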